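{- Let $j,r\ge 0$ and $k\ge 1$ be integers with $j+r\le k$. Then \[ \sum_{s_1\ge\cdots\ge s_k\ge 0}\frac{q^{s_1^2+\cdots+s_k^2-s_1-\cdots-s_j+\sum_{i=k-r+1}^{k}s_i+s_k}}{(q)_{s_1-s_2}\cdots(q)_{s_{k-1}-s_k}(q^2;q^2)_{s_k}}=\sum_{f}q^{|f|}, \] where the sum on the right runs over all frequency sequences $f=(f_i)_{i\ge0}$ such that (i) $f_i+f_{i+1}\le k$ for all $i\ge0$, (ii) $f_0\le j-\max\{f_0+f_1-(k-r),0\}$, and (iii) whenever $f_i+f_{i+1}=k$ for some $i\ge0$, we have $if_i+(i+1)f_{i+1}\equiv k+r-j+1\pmod 2$. (The exponent $\sum_{i=k-r+1}^k s_i+s_k$ is the paper's $s_{k-r+1}+\cdots+s_{k-1}+2s_k$.)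
   Context: A frequency sequence is a sequence $(f_i)_{i\ge0}$ of non-negative integers with only finitely many nonzero entries; its size is $|f|=\sum_{i\ge0} i f_i$. $q$ is a complex number with $|q|<1$ (or a formal variable); $(a;q)_n=\prod_{m=0}^{n-1}(1-aq^m)$, $(a)_n=(a;q)_n$. $s_1+\cdots+s_j=\sum_{i=1}^j s_i$. -}

module Defs where

open import Data.Nat using (ℕ; zero; suc; _+_; _*_; _∸_; _≤_; _≤ᵇ_; _%_)
open import Data.Nat.Divisibility using (_∣?_)
open import Data.Bool using (Bool; true; false; if_then_else_; _∧_)
open import Data.Nat.ListAction using (sum)
open import Data.List using (List; []; _∷_; map; upTo; concatMap; take; drop; length)
open import Data.Empty using (⊥)
open import Data.Unit using (⊤)
open import Relation.Nullary using (¬_)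
open import Relation.Nullary.Decidable using (⌊_⌋)
open import Relation.Binary.PropositionalEquality using (_≡_)

-- Formal power series in q with ℕ coefficients, as coefficient functions.

Series : Set
Series = ℕ → ℕ

one : Series
one zero    = 1
one (suc _) = 0

_⊛_ : Series → Series → Series
(A ⊛ B) n = sum (map (λ i → A i * B (n ∸ i)) (upTo (suc n)))

shift : ℕ → Series → Series
shift e A n = if e ≤ᵇ n then A (n ∸ e) else 0

-- 1/(1 - q^d) = Σ_{m≥0} q^{d m}   (used for d ≥ 1)
geom : ℕ → Series
geom d n with d
... | zero  = one n
... | suc d' = if ⌊ suc d' ∣? n ⌋ then 1 else 0

invPoch : ℕ → Series
invPoch zero    = one
invPoch (suc m) = geom (suc m) ⊛ invPoch m

invPoch2 : ℕ → Series
invPoch2 zero    = one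
invPoch2 (suc m) = geom (2 * suc m) ⊛ invPoch2 m

-- Left-hand side.  A tuple (s_1,…,s_k) is the list s_1 ∷ … ∷ s_k ∷ [].

box : ℕ → ℕ → List (List ℕ)
box zero    N = [] ∷ []
box (suc k) N = concatMap (λ x → map (x ∷_) (box k N)) (upTo (suc N))

decreasing : List ℕ → Bool
decreasing []           = true
decreasing (x ∷ [])     = true
decreasing (x ∷ y ∷ s)  = (y ≤ᵇ x) ∧ decreasing (y ∷ s)

lastOr0 : List ℕ → ℕ
lastOr0 []          = 0
lastOr0 (x ∷ [])    = x
lastOr0 (x ∷ y ∷ s) = lastOr0 (y ∷ s)

-- exponent  s_1²+⋯+s_k² − (s_1+⋯+s_j) + Σ_{i=k-r+1}^{k} s_i + s_k
-- (non-negative since s_i² ≥ s_i, so truncated subtraction is exact)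
expo : (j r k : ℕ) → List ℕ → ℕ
expo j r k s =
  (sum (map (λ x → x * x) s) + sum (drop (k ∸ r) s) + lastOr0 s) ∸ sum (take j s)

denInv : List ℕ → Series
denInv []          = one
denInv (x ∷ [])    = invPoch2 x
denInv (x ∷ y ∷ s) = invPoch (x ∸ y) ⊛ denInv (y ∷ s)

lhsPartial : (j r k N n : ℕ) → ℕ
lhsPartial j r k N n =
  sum (map (λ s → if decreasing s then shift (expo j r k s) (denInv s) n else 0)
           (box k N))

-- Frequency sequences: (f_0, f_1, …) with finite support is represented
-- canonically by the list f_0 ∷ ⋯ ∷ f_m ∷ [] without trailing zeros.

NoTrailingZero : List ℕ → Set
NoTrailingZero []          = ⊤
NoTrailingZero (x ∷ [])    = ¬ (x ≡ 0)
NoTrailingZero (x ∷ y ∷ f) = NoTrailingZero (y ∷ f)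

get : List ℕ → ℕ → ℕ
get []      _       = 0
get (x ∷ f) zero    = x
get (x ∷ f) (suc i) = get f i

sizeFrom : ℕ → List ℕ → ℕ
sizeFrom i []      = 0
sizeFrom i (x ∷ f) = i * x + sizeFrom (suc i) f

size : List ℕ → ℕ
size = sizeFrom 0

record Cond (j r k : ℕ) (f : List ℕ) : Set where
  field
    cond-i   : ∀ i → get f i + get f (suc i) ≤ k
    -- f_0 ≤ j − max{f_0+f_1−(k−r), 0}
    cond-ii  : get f 0 + ((get f 0 + get f 1) ∸ (k ∸ r)) ≤ j
    cond-iii : ∀ i → get f i + get f (suc i) ≡ k →
               (i * get f i + suc i * get f (suc i)) % 2 ≡ ((k + r ∸ j) + 1) % 2

{-# OPTIONS --safe #-}
module Submission where

-- Let G_{j,r}(x) be the multisum with weight x^{s_1+⋯+s_k}, with (q)_{s_k} instead of (q²;q²)_{s_k} and without the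
-- extra s_k. Substituting s_i = t_i + p, where p = s_k, turns a (k+1)-fold sum into Σ_p of a k-fold sum at x q^{2p};
-- this preserves, by induction on k, the recurrence  G_{j,r}(x) = G_{j−1,r−1}(x) + x^j G_{k−r−j,0}(xq)
-- of sequences split according to whether f_0 = j. The only identity on the denominators that is needed is
-- 1/(q)_p = 1/(q)_{p−1} + q^p/(q)_p. With (q²;q²)_p instead, the same step has period two: the recurrences for the
-- exponents with and without the extra s_k alternate, which is the parity condition (iii).

open import Defs
open import Data.Nat
open import Data.Nat.Properties
open import Data.Nat.DivMod using ([m+kn]%n≡m%n; m%n<n)
open import Data.Nat.Divisibility
open import Data.Nat.ListAction using (sum)
open import Data.Nat.ListAction.Properties using (sum-++)
open import Data.Nat.Solver using (module +-*-Solver)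
open import Data.Bool using (true; false; if_then_else_; _∧_; T)
open import Data.List using (List; []; _∷_; _++_; map; upTo; applyUpTo; concatMap; take; drop; length)
open import Data.List.Properties using (map-∘; map-++; length-++; length-map; map-applyUpTo; take++drop≡id)
open import Data.List.Membership.Propositional using (_∈_)
open import Data.List.Membership.Propositional.Properties using (∈-map⁺; ∈-map⁻; ∈-++⁺ˡ; ∈-++⁺ʳ; ∈-++⁻)
open import Data.List.Relation.Unary.All using ([])
open import Data.List.Relation.Unary.AllPairs using ([]; _∷_)
open import Data.List.Relation.Unary.Any using (here)
open import Data.List.Relation.Unary.Unique.Propositional using (Unique)
open import Data.List.Relation.Unary.Unique.Propositional.Properties using (map⁺; ++⁺)
open import Data.Product using (Σ; _×_; ∃; _,_; proj₁; proj₂)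
open import Data.Sum using (_⊎_; inj₁; inj₂)
open import Data.Empty using (⊥; ⊥-elim)
open import Data.Unit using (⊤; tt)
open import Function using (_∘_; id)
open import Function.Bundles using (_⇔_; mk⇔)
open import Relation.Nullary using (¬_; Dec; yes; no)
open import Relation.Nullary.Decidable using (⌊_⌋; isYes≗does; dec-true; dec-false)
open import Relation.Binary.PropositionalEquality

open +-*-Solver using (solve; _:+_; _:*_; _:=_; con)

-- Only the values x = q^m occur, so a natural number m replaces x and all series have one variable.
-- The multisum is layered by its innermost variable, while sequences are split by their first
-- entry; the two meet in a balance of exponents. For r ≥ 1 this balance is exact. For r = 0 the
-- coefficient of s_k is too small by one and has to be raised through the denominator of s_k. What
-- comes out is the desired recurrence composed with itself, so the crux is to undo a composition.
-- The denominator (q²;q²)_p raises the coefficient by two at once, hence two kinds of exponent,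
-- told apart by a parity δ. The index r matters only at position 0: the recurrence with r ≥ 1
-- removes f_0 = j, j-1, ... one value at a time, lowering j and r together. The bounds that it
-- leaves on f_1 are condition (ii). The quantity k+r-j+1 stays constant along this descent, and its
-- parity is the one for which the multisum that remains at r = 0 carries its extra s_k.

-- Finite sums.

∑ : ℕ → (ℕ → ℕ) → ℕ
∑ zero    f = 0
∑ (suc N) f = f 0 + ∑ N (f ∘ suc)

sum-map-upTo : ∀ (f : ℕ → ℕ) N → sum (map f (upTo N)) ≡ ∑ N f
sum-map-upTo f N = trans (cong sum (map-applyUpTo id f N)) (go f N)
  where
  go : ∀ f N → sum (applyUpTo f N) ≡ ∑ N f
  go f zero    = refl
  go f (suc N) = cong (f 0 +_) (go (f ∘ suc) N)

∑-cong : ∀ N {f g : ℕ → ℕ} → (∀ i → i < N → f i ≡ g i) → ∑ N f ≡ ∑ N g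
∑-cong zero    h = refl
∑-cong (suc N) h = cong₂ _+_ (h 0 z<s) (∑-cong N λ i i<N → h (suc i) (s<s i<N))

∑-zero : ∀ N {f : ℕ → ℕ} → (∀ i → i < N → f i ≡ 0) → ∑ N f ≡ 0
∑-zero zero    h = refl
∑-zero (suc N) h = cong₂ _+_ (h 0 z<s) (∑-zero N λ i i<N → h (suc i) (s<s i<N))

∑-+ : ∀ N (f g : ℕ → ℕ) → ∑ N (λ i → f i + g i) ≡ ∑ N f + ∑ N g
∑-+ zero    f g = refl
∑-+ (suc N) f g = trans (cong (f 0 + g 0 +_) (∑-+ N (f ∘ suc) (g ∘ suc)))
  (solve 4 (λ a b c d → (a :+ b) :+ (c :+ d) := (a :+ c) :+ (b :+ d)) refl
    (f 0) (g 0) (∑ N (f ∘ suc)) (∑ N (g ∘ suc)))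

∑-*ˡ : ∀ N c (f : ℕ → ℕ) → c * ∑ N f ≡ ∑ N (λ i → c * f i)
∑-*ˡ zero    c f = *-zeroʳ c
∑-*ˡ (suc N) c f = trans (*-distribˡ-+ c (f 0) _) (cong (c * f 0 +_) (∑-*ˡ N c (f ∘ suc)))

∑-last : ∀ N (f : ℕ → ℕ) → ∑ (suc N) f ≡ ∑ N f + f N
∑-last zero    f = +-identityʳ (f 0)
∑-last (suc N) f = trans (cong (f 0 +_) (∑-last N (f ∘ suc))) (sym (+-assoc (f 0) _ _))

∑-truncate : ∀ {M N} {f : ℕ → ℕ} → M ≤ N → (∀ i → M ≤ i → f i ≡ 0) → ∑ N f ≡ ∑ M f
∑-truncate {N = N} z≤n h = ∑-zero N λ i _ → h i z≤n
∑-truncate {f = f} (s≤s M≤N) h = cong (f 0 +_) (∑-truncate M≤N λ i M≤i → h (suc i) (s≤s M≤i))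

∑-triangle : ∀ N (h : ℕ → ℕ → ℕ) →
  ∑ N (λ i → ∑ (N ∸ i) (h i)) ≡ ∑ N (λ l → ∑ (N ∸ l) (λ i → h i l))
∑-triangle zero    h = refl
∑-triangle (suc N) h = begin
  ∑ (suc N) (h 0) + ∑ N (λ i → ∑ (N ∸ i) (h (suc i)))
    ≡⟨ cong (∑ (suc N) (h 0) +_) (∑-triangle N (h ∘ suc)) ⟩
  ∑ (suc N) (h 0) + ∑ N (λ l → ∑ (N ∸ l) (λ i → h (suc i) l))
    ≡⟨ cong (∑ (suc N) (h 0) +_) (sym (∑-truncate (n≤1+n N) (λ l N≤l → cong (λ d → ∑ d (λ i → h (suc i) l)) (m≤n⇒m∸n≡0 N≤l)))) ⟩
  ∑ (suc N) (h 0) + ∑ (suc N) (λ l → ∑ (N ∸ l) (λ i → h (suc i) l))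
    ≡⟨ sym (∑-+ (suc N) (h 0) (λ l → ∑ (N ∸ l) (λ i → h (suc i) l))) ⟩
  ∑ (suc N) (λ l → h 0 l + ∑ (N ∸ l) (λ i → h (suc i) l))
    ≡⟨ ∑-cong (suc N) (λ l l≤N → cong (λ d → ∑ d (λ i → h i l)) (sym (+-∸-assoc 1 (s≤s⁻¹ l≤N)))) ⟩
  ∑ (suc N) (λ l → ∑ (suc N ∸ l) (λ i → h i l)) ∎
  where open ≡-Reasoning

-- Power series: sum, multiplication by a power of q, convolution.

infixl 6 _⊕_
_⊕_ : Series → Series → Series
(A ⊕ B) n = A n + B n

0# : Series
0# _ = 0

shift-suc : ∀ e A n → shift (suc e) A (suc n) ≡ shift e A n
shift-suc zero    A n = refl
shift-suc (suc e) A n = refl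

shift-below : ∀ {e n} A → n < e → shift e A n ≡ 0
shift-below {suc e} {zero}  A _ = refl
shift-below {suc e} {suc n} A (s<s n<e) = trans (shift-suc e A n) (shift-below A n<e)

shift-above : ∀ e A n → shift e A (e + n) ≡ A n
shift-above zero    A n = refl
shift-above (suc e) A n = trans (shift-suc e A (e + n)) (shift-above e A n)

data Position (e : ℕ) : ℕ → Set where
  below : ∀ {n} → n < e → Position e n
  above : ∀ n → Position e (e + n)

position : ∀ e n → Position e n
position e n with n <? e
... | yes n<e = below n<e
... | no  n≮e = subst (Position e) (m+[n∸m]≡n (≮⇒≥ n≮e)) (above (n ∸ e))

-- Agreement is demanded only at i with `e + i ≤ n`. This bound carries the later inductions on the
-- degree.
shift-cong : ∀ e {A B} n → (∀ i → e + i ≤ n → A i ≡ B i) → shift e A n ≡ shift e B n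
shift-cong e {A} {B} n h with position e n
... | below n<e = trans (shift-below A n<e) (sym (shift-below B n<e))
... | above i   = trans (shift-above e A i) (trans (h i ≤-refl) (sym (shift-above e B i)))

shift-⊕ : ∀ e A B n → shift e (A ⊕ B) n ≡ shift e A n + shift e B n
shift-⊕ e A B n with e ≤ᵇ n
... | true  = refl
... | false = refl

shift-0# : ∀ e n → shift e 0# n ≡ 0
shift-0# e n with e ≤ᵇ n
... | true  = refl
... | false = refl

shift-+ : ∀ a b A n → shift (a + b) A n ≡ shift a (shift b A) n
shift-+ zero    b A n       = refl
shift-+ (suc a) b A zero    = refl
shift-+ (suc a) b A (suc n) =
  trans (shift-suc (a + b) A n) (trans (shift-+ a b A n) (sym (shift-suc a (shift b A) n)))

shift-∑ : ∀ e N (A : ℕ → Series) n → shift e (λ i → ∑ N (λ x → A x i)) n ≡ ∑ N (λ x → shift e (A x) n)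
shift-∑ e zero    A n = shift-0# e n
shift-∑ e (suc N) A n =
  trans (shift-⊕ e (A 0) (λ i → ∑ N (λ x → A (suc x) i)) n) (cong (shift e (A 0) n +_) (shift-∑ e N (A ∘ suc) n))

⊛-∑ : ∀ A B n → (A ⊛ B) n ≡ ∑ (suc n) (λ i → A i * B (n ∸ i))
⊛-∑ A B n = sum-map-upTo (λ i → A i * B (n ∸ i)) (suc n)

⊛-cong : ∀ {A A' B B'} n → (∀ i → i ≤ n → A i ≡ A' i) → (∀ i → i ≤ n → B i ≡ B' i) →
  (A ⊛ B) n ≡ (A' ⊛ B') n
⊛-cong {A} {A'} {B} {B'} n h h' = trans (⊛-∑ A B n) (trans
  (∑-cong (suc n) λ i i≤n → cong₂ _*_ (h i (s≤s⁻¹ i≤n)) (h' (n ∸ i) (m∸n≤m n i)))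
  (sym (⊛-∑ A' B' n)))

⊛-congʳ : ∀ A {B B'} n → (∀ i → i ≤ n → B i ≡ B' i) → (A ⊛ B) n ≡ (A ⊛ B') n
⊛-congʳ A n = ⊛-cong {A} {A} n λ _ _ → refl

⊛-distribˡ : ∀ A B C n → (A ⊛ (B ⊕ C)) n ≡ (A ⊛ B) n + (A ⊛ C) n
⊛-distribˡ A B C n = begin
  (A ⊛ (B ⊕ C)) n                                       ≡⟨ ⊛-∑ A (B ⊕ C) n ⟩
  ∑ (suc n) (λ i → A i * (B (n ∸ i) + C (n ∸ i)))        ≡⟨ ∑-cong (suc n) (λ i _ → *-distribˡ-+ (A i) (B (n ∸ i)) (C (n ∸ i))) ⟩
  ∑ (suc n) (λ i → A i * B (n ∸ i) + A i * C (n ∸ i))    ≡⟨ ∑-+ (suc n) (λ i → A i * B (n ∸ i)) (λ i → A i * C (n ∸ i)) ⟩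
  ∑ (suc n) (λ i → A i * B (n ∸ i)) + ∑ (suc n) (λ i → A i * C (n ∸ i))                                                 ≡⟨ cong₂ _+_ (⊛-∑ A B n) (⊛-∑ A C n) ⟨
  (A ⊛ B) n + (A ⊛ C) n ∎
  where open ≡-Reasoning

⊛-zeroʳ : ∀ A n → (A ⊛ 0#) n ≡ 0
⊛-zeroʳ A n = trans (⊛-∑ A 0# n) (∑-zero (suc n) λ i _ → *-zeroʳ (A i))

⊛-distribˡ-∑ : ∀ A N (B : ℕ → Series) n → (A ⊛ (λ i → ∑ N (λ x → B x i))) n ≡ ∑ N (λ x → (A ⊛ B x) n)
⊛-distribˡ-∑ A zero    B n = ⊛-zeroʳ A n
⊛-distribˡ-∑ A (suc N) B n =
  trans (⊛-distribˡ A (B 0) (λ i → ∑ N (λ x → B (suc x) i)) n) (cong ((A ⊛ B 0) n +_) (⊛-distribˡ-∑ A N (B ∘ suc) n))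

⊛-identityˡ : ∀ A n → (one ⊛ A) n ≡ A n
⊛-identityˡ A n = trans (⊛-∑ one A n) (trans
  (cong (1 * A n +_) (∑-zero n λ _ _ → refl)) (trans (+-identityʳ _) (*-identityˡ _)))

⊛-identityʳ : ∀ A n → (A ⊛ one) n ≡ A n
⊛-identityʳ A n = trans (⊛-∑ A one n) (trans (∑-last n (λ i → A i * one (n ∸ i))) (cong₂ _+_
    (∑-zero n λ i i<n → trans (cong (A i *_) (one-positive (m<n⇒0<n∸m i<n))) (*-zeroʳ (A i)))
    (trans (cong (λ d → A n * one d) (n∸n≡0 n)) (*-identityʳ (A n)))))
  where
  one-positive : ∀ {i} → 0 < i → one i ≡ 0
  one-positive z<s = refl

-- Both sides are one triple sum with the order of two indices exchanged. The case `C = one` gives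
-- commutativity; the general case later moves the factor of the innermost variable to the front of
-- a denominator.
⊛-left-comm : ∀ A B C n → (A ⊛ (B ⊛ C)) n ≡ (B ⊛ (A ⊛ C)) n
⊛-left-comm A B C n = begin
  (A ⊛ (B ⊛ C)) n
    ≡⟨ expand A B ⟩
  ∑ (suc n) (λ i → ∑ (suc n ∸ i) (λ l → A i * (B l * C (n ∸ i ∸ l))))
    ≡⟨ ∑-triangle (suc n) (λ i l → A i * (B l * C (n ∸ i ∸ l))) ⟩
  ∑ (suc n) (λ l → ∑ (suc n ∸ l) (λ i → A i * (B l * C (n ∸ i ∸ l))))
    ≡⟨ ∑-cong (suc n) (λ l _ → ∑-cong (suc n ∸ l) (λ i _ → swap i l)) ⟩
  ∑ (suc n) (λ l → ∑ (suc n ∸ l) (λ i → B l * (A i * C (n ∸ l ∸ i))))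
    ≡⟨ expand B A ⟨
  (B ⊛ (A ⊛ C)) n ∎
  where
  open ≡-Reasoning
  expand : ∀ A B → (A ⊛ (B ⊛ C)) n ≡ ∑ (suc n) (λ i → ∑ (suc n ∸ i) (λ l → A i * (B l * C (n ∸ i ∸ l))))
  expand A B = trans (⊛-∑ A (B ⊛ C) n) (∑-cong (suc n) λ i i≤n → trans
    (cong (A i *_) (⊛-∑ B C (n ∸ i))) (trans (∑-*ˡ (suc (n ∸ i)) (A i) (λ l → B l * C (n ∸ i ∸ l)))
    (cong (λ d → ∑ d (λ l → A i * (B l * C (n ∸ i ∸ l)))) (sym (+-∸-assoc 1 (s≤s⁻¹ i≤n))))))
  swap : ∀ i l → A i * (B l * C (n ∸ i ∸ l)) ≡ B l * (A i * C (n ∸ l ∸ i))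
  swap i l = trans (solve 3 (λ a b c → a :* (b :* c) := b :* (a :* c)) refl (A i) (B l) (C (n ∸ i ∸ l)))
    (cong (λ d → B l * (A i * C d)) (trans (∸-+-assoc n i l) (trans (cong (n ∸_) (+-comm i l)) (sym (∸-+-assoc n l i)))))

⊛-comm : ∀ A B n → (A ⊛ B) n ≡ (B ⊛ A) n
⊛-comm A B n = begin
  (A ⊛ B) n         ≡⟨ ⊛-congʳ A n (λ i _ → ⊛-identityʳ B i) ⟨
  (A ⊛ (B ⊛ one)) n ≡⟨ ⊛-left-comm A B one n ⟩
  (B ⊛ (A ⊛ one)) n ≡⟨ ⊛-congʳ B n (λ i _ → ⊛-identityʳ A i) ⟩
  (B ⊛ A) n         ∎
  where open ≡-Reasoning

⊛-distribʳ : ∀ A B C n → ((A ⊕ B) ⊛ C) n ≡ (A ⊛ C) n + (B ⊛ C) n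
⊛-distribʳ A B C n = trans (⊛-comm (A ⊕ B) C n)
  (trans (⊛-distribˡ C A B n) (cong₂ _+_ (⊛-comm C A n) (⊛-comm C B n)))

shift-⊛ : ∀ e A B n → (shift e A ⊛ B) n ≡ shift e (A ⊛ B) n
shift-⊛ zero    A B n       = refl
shift-⊛ (suc e) A B zero    = refl
shift-⊛ (suc e) A B (suc n) = begin
  (shift (suc e) A ⊛ B) (suc n)                              ≡⟨ ⊛-∑ (shift (suc e) A) B (suc n) ⟩
  ∑ (suc n) (λ i → shift (suc e) A (suc i) * B (n ∸ i))       ≡⟨ ∑-cong (suc n) (λ i _ → cong (_* B (n ∸ i)) (shift-suc e A i)) ⟩
  ∑ (suc n) (λ i → shift e A i * B (n ∸ i))                   ≡⟨ ⊛-∑ (shift e A) B n ⟨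
  (shift e A ⊛ B) n                                          ≡⟨ shift-⊛ e A B n ⟩
  shift e (A ⊛ B) n                                          ≡⟨ shift-suc e (A ⊛ B) n ⟨
  shift (suc e) (A ⊛ B) (suc n)                              ∎
  where open ≡-Reasoning

⊛-shift : ∀ e A B n → (A ⊛ shift e B) n ≡ shift e (A ⊛ B) n
⊛-shift e A B n = trans (⊛-comm A (shift e B) n)
  (trans (shift-⊛ e B A n) (shift-cong e n λ i _ → ⊛-comm B A i))

-- Geometric series and inverse q-factorials.

isYes-true : ∀ {P : Set} (P? : Dec P) → P → ⌊ P? ⌋ ≡ true
isYes-true P? p = trans (isYes≗does P?) (dec-true P? p)

isYes-false : ∀ {P : Set} (P? : Dec P) → ¬ P → ⌊ P? ⌋ ≡ false
isYes-false P? ¬p = trans (isYes≗does P?) (dec-false P? ¬p)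

geom-step : ∀ d n → geom (suc d) n ≡ one n + shift (suc d) (geom (suc d)) n
geom-step d n with position (suc d) n
geom-step d zero     | below n<d = cong (if_then 1 else 0) (isYes-true (suc d ∣? 0) (suc d ∣0))
geom-step d (suc n)  | below n<d = trans
  (cong (if_then 1 else 0) (isYes-false (suc d ∣? suc n) (λ div → <⇒≱ n<d (∣⇒≤ div))))
  (sym (shift-below (geom (suc d)) n<d))
geom-step d .(suc d + i) | above i = trans (cong (if_then 1 else 0) same) (sym (shift-above (suc d) (geom (suc d)) i))
  where
  same : ⌊ suc d ∣? (suc d + i) ⌋ ≡ ⌊ suc d ∣? i ⌋
  same with suc d ∣? i
  ... | yes div = isYes-true (suc d ∣? (suc d + i)) (∣m∣n⇒∣m+n ∣-refl div)
  ... | no ¬div = isYes-false (suc d ∣? (suc d + i)) (λ div → ¬div (∣m+n∣m⇒∣n div ∣-refl))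

-- (1 − q^{t(p+1)}) D_{p+1} = D_p, i.e. D_p = 1/(q^t; q^t)_p.
InversePochhammer : ℕ → (ℕ → Series) → Set
InversePochhammer t D = D 0 ≡ one × (∀ p n → D (suc p) n ≡ D p n + shift (t * suc p) (D (suc p)) n)

geom-⊛ : ∀ d A n → (geom (suc d) ⊛ A) n ≡ A n + shift (suc d) (geom (suc d) ⊛ A) n
geom-⊛ d A n = begin
  (geom (suc d) ⊛ A) n                                   ≡⟨ ⊛-cong {B = A} n (λ i _ → geom-step d i) (λ _ _ → refl) ⟩
  ((one ⊕ shift (suc d) (geom (suc d))) ⊛ A) n           ≡⟨ ⊛-distribʳ one (shift (suc d) (geom (suc d))) A n ⟩
  (one ⊛ A) n + (shift (suc d) (geom (suc d)) ⊛ A) n     ≡⟨ cong₂ _+_ (⊛-identityˡ A n) (shift-⊛ (suc d) (geom (suc d)) A n) ⟩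
  A n + shift (suc d) (geom (suc d) ⊛ A) n               ∎
  where open ≡-Reasoning

invPoch-isInverse : InversePochhammer 1 invPoch
invPoch-isInverse = refl , λ p n → trans (geom-⊛ p (invPoch p) n)
  (cong (λ e → invPoch p n + shift e (invPoch (suc p)) n) (sym (*-identityˡ (suc p))))

invPoch2-isInverse : InversePochhammer 2 invPoch2
invPoch2-isInverse = refl , λ p n → geom-⊛ _ (invPoch2 p) n

-- Summation over the innermost variable as an operator.

weight : ℕ → ℕ → ℕ → ℕ → ℕ
weight K x m p = K * (p * (p ∸ 1)) + p * (m * K + x)

-- The effect of summing over the innermost variable s_k = p after the substitution s_i = t_i + p:
-- L is the remaining (k−1)-fold sum, and its argument m stands for x = q^m in x^{s_1+⋯+s_k}.
layer : (ℕ → Series) → ℕ → ℕ → (ℕ → Series) → ℕ → Series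
term  : (ℕ → Series) → ℕ → ℕ → (ℕ → Series) → ℕ → ℕ → Series
layer D K x L m n = ∑ (2 + n) (λ p → term D K x L m p n)
term D K x L m p = shift (weight K x m p) (D p ⊛ L (m + 2 * p))

-- Sharp at p = 1 with m = x = 0, because p(p-1) vanishes at 1 as well as at 0. Hence degree n can
-- involve p up to n+1, and `layer` has `2 + n` terms.
p≤1+weight : ∀ k x m p → p ≤ suc (weight (suc k) x m p)
p≤1+weight k x m zero    = z≤n
p≤1+weight k x m (suc p) = s≤s (≤-trans (m≤m+n p _) (≤-trans (m≤m+n (p + p * p) (k * (p + p * p))) (m≤m+n (suc k * (suc p * p)) (suc p * (m * suc k + x)))))

module _ (D : ℕ → Series) (k x : ℕ) (L : ℕ → Series) (m : ℕ) where

  private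
    K = suc k

  term-vanishes : ∀ n p → 2 + n ≤ p → term D K x L m p n ≡ 0
  term-vanishes n p n<p = shift-below (D p ⊛ L (m + 2 * p)) (s≤s⁻¹ (≤-trans n<p (p≤1+weight k x m p)))

  -- The range of `layer` depends on the degree; a common range N makes layers at different degrees
  -- comparable term by term.
  layer-truncate : ∀ {n N} → 2 + n ≤ N → layer D K x L m n ≡ ∑ N (λ p → term D K x L m p n)
  layer-truncate {n} n≤N = sym (∑-truncate n≤N (term-vanishes n))

  shift-layer : ∀ e {n N} → 2 + n ≤ N →
    shift e (layer D K x L m) n ≡ ∑ N (λ p → shift e (term D K x L m p) n)
  shift-layer e {n} {N} n≤N = trans
    (shift-cong e n λ i e+i≤n → layer-truncate (≤-trans (s≤s (s≤s (≤-trans (m≤n+m i e) e+i≤n))) n≤N))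
    (shift-∑ e N (term D K x L m) n)

module _ (D : ℕ → Series) (k : ℕ) where

  private
    K = suc k

  -- At p the factor q^{μj} has μ = m + 2p, so it gives q^{mj} outside the sum and 2pj inside;
  -- moving from m to m+1 absorbs pK. The two sides therefore balance when `K + y ≡ x + 2 * j`.
  layer-split : ∀ {x y j} L L₁ L₂ m → K + y ≡ x + 2 * j →
    (∀ μ n → L μ n ≡ L₁ μ n + shift (μ * j) (L₂ (suc μ)) n) →
    ∀ n → layer D K x L m n ≡ layer D K x L₁ m n + shift (m * j) (layer D K y L₂ (suc m)) n
  layer-split {x} {y} {j} L L₁ L₂ m K+y h n = begin
    ∑ N (λ p → term D K x L m p n)
      ≡⟨ ∑-cong N (λ p _ → termwise p) ⟩
    ∑ N (λ p → term D K x L₁ m p n + shift (m * j) (term D K y L₂ (suc m) p) n)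
      ≡⟨ ∑-+ N (λ p → term D K x L₁ m p n) (λ p → shift (m * j) (term D K y L₂ (suc m) p) n) ⟩
    layer D K x L₁ m n + ∑ N (λ p → shift (m * j) (term D K y L₂ (suc m) p) n)
      ≡⟨ cong (layer D K x L₁ m n +_) (shift-layer D k y L₂ (suc m) (m * j) {n} ≤-refl) ⟨
    layer D K x L₁ m n + shift (m * j) (layer D K y L₂ (suc m)) n ∎
    where
    open ≡-Reasoning
    N = 2 + n
    exponents : ∀ p → weight K x m p + (m + 2 * p) * j ≡ m * j + weight K y (suc m) p
    exponents p = begin
      weight K x m p + (m + 2 * p) * j
        ≡⟨ solve 6 (λ Q p m K x j → (Q :+ p :* (m :* K :+ x)) :+ (m :+ con 2 :* p) :* j
             := (m :* j :+ Q :+ p :* (m :* K)) :+ p :* (x :+ con 2 :* j)) refl (K * (p * (p ∸ 1))) p m K x j ⟩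
      m * j + K * (p * (p ∸ 1)) + p * (m * K) + p * (x + 2 * j)
        ≡⟨ cong (λ z → m * j + K * (p * (p ∸ 1)) + p * (m * K) + p * z) (sym K+y) ⟩
      m * j + K * (p * (p ∸ 1)) + p * (m * K) + p * (K + y)
        ≡⟨ solve 6 (λ Q p m K y j → (m :* j :+ Q :+ p :* (m :* K)) :+ p :* (K :+ y)
             := m :* j :+ (Q :+ p :* ((con 1 :+ m) :* K :+ y))) refl (K * (p * (p ∸ 1))) p m K y j ⟩
      m * j + weight K y (suc m) p ∎
    termwise : ∀ p → term D K x L m p n ≡ term D K x L₁ m p n + shift (m * j) (term D K y L₂ (suc m) p) n
    termwise p = begin
      shift E (D p ⊛ L μ) n
        ≡⟨ shift-cong E n (λ i _ → trans (⊛-congʳ (D p) i (λ i _ → h μ i)) (⊛-distribˡ (D p) (L₁ μ) (shift (μ * j) (L₂ (suc μ))) i)) ⟩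
      shift E ((D p ⊛ L₁ μ) ⊕ (D p ⊛ shift (μ * j) (L₂ (suc μ)))) n
        ≡⟨ shift-⊕ E (D p ⊛ L₁ μ) (D p ⊛ shift (μ * j) (L₂ (suc μ))) n ⟩
      shift E (D p ⊛ L₁ μ) n + shift E (D p ⊛ shift (μ * j) (L₂ (suc μ))) n
        ≡⟨ cong (shift E (D p ⊛ L₁ μ) n +_) (shift-cong E n λ i _ → ⊛-shift (μ * j) (D p) (L₂ (suc μ)) i) ⟩
      shift E (D p ⊛ L₁ μ) n + shift E (shift (μ * j) (D p ⊛ L₂ (suc μ))) n
        ≡⟨ cong (shift E (D p ⊛ L₁ μ) n +_) (trans (sym (shift-+ E (μ * j) (D p ⊛ L₂ (suc μ)) n))
             (trans (cong (λ e → shift e (D p ⊛ L₂ (suc μ)) n) (exponents p))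
               (shift-+ (m * j) (weight K y (suc m) p) (D p ⊛ L₂ (suc μ)) n))) ⟩
      shift E (D p ⊛ L₁ μ) n + shift (m * j) (term D K y L₂ (suc m) p) n ∎
      where
      E = weight K x m p
      μ = m + 2 * p

  -- For p ≥ 1 write D_p = D_{p-1} + q^{tp} D_p. The second part is the same layer with x raised by
  -- t, and p = 0 joins it since its weight is 0 for every x. In the first part, lowering p by one
  -- turns m into m+2 and leaves the factor q^{mK+x}.
  layer-peel : ∀ {t x} L m → InversePochhammer t D →
    ∀ n → layer D K x L m n ≡ layer D K (x + t) L m n + shift (m * K + x) (layer D K x L (2 + m)) n
  layer-peel {t} {x} L m (D₀ , D₊) n = begin
    layer D K x L m n
      ≡⟨ layer-truncate D k x L m {n} (n≤1+n N) ⟩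
    term D K x L m 0 n + ∑ N (λ p → term D K x L m (suc p) n)
      ≡⟨ cong₂ _+_ first (trans (∑-cong N λ p _ → termwise p)
           (∑-+ N (λ p → term D K (x + t) L m (suc p) n) (λ p → shift e (term D K x L (2 + m) p) n))) ⟩
    term D K (x + t) L m 0 n + (∑ N (λ p → term D K (x + t) L m (suc p) n) + ∑ N (λ p → shift e (term D K x L (2 + m) p) n))
      ≡⟨ +-assoc (term D K (x + t) L m 0 n) (∑ N (λ p → term D K (x + t) L m (suc p) n)) (∑ N (λ p → shift e (term D K x L (2 + m) p) n)) ⟨
    ∑ (suc N) (λ p → term D K (x + t) L m p n) + ∑ N (λ p → shift e (term D K x L (2 + m) p) n)
      ≡⟨ cong₂ _+_ (layer-truncate D k (x + t) L m {n} (n≤1+n N)) (shift-layer D k x L (2 + m) e {n} ≤-refl) ⟨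
    layer D K (x + t) L m n + shift e (layer D K x L (2 + m)) n ∎
    where
    open ≡-Reasoning
    N = 2 + n
    e = m * K + x
    first : term D K x L m 0 n ≡ term D K (x + t) L m 0 n
    first = refl
    termwise : ∀ p → term D K x L m (suc p) n ≡ term D K (x + t) L m (suc p) n + shift e (term D K x L (2 + m) p) n
    termwise p = begin
      shift E (D (suc p) ⊛ Lμ) n
        ≡⟨ shift-cong E n (λ i _ → trans (⊛-cong {B = Lμ} i (λ i _ → D₊ p i) (λ _ _ → refl)) (⊛-distribʳ (D p) (shift (t * suc p) (D (suc p))) Lμ i)) ⟩
      shift E ((D p ⊛ Lμ) ⊕ (shift (t * suc p) (D (suc p)) ⊛ Lμ)) n
        ≡⟨ shift-⊕ E (D p ⊛ Lμ) (shift (t * suc p) (D (suc p)) ⊛ Lμ) n ⟩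
      shift E (D p ⊛ Lμ) n + shift E (shift (t * suc p) (D (suc p)) ⊛ Lμ) n
        ≡⟨ +-comm (shift E (D p ⊛ Lμ) n) _ ⟩
      shift E (shift (t * suc p) (D (suc p)) ⊛ Lμ) n + shift E (D p ⊛ Lμ) n
        ≡⟨ cong₂ _+_ left right ⟩
      term D K (x + t) L m (suc p) n + shift e (term D K x L (2 + m) p) n ∎
      where
      E = weight K x m (suc p)
      Lμ = L (m + 2 * suc p)
      left : shift E (shift (t * suc p) (D (suc p)) ⊛ Lμ) n ≡ term D K (x + t) L m (suc p) n
      left = trans (shift-cong E n λ i _ → shift-⊛ (t * suc p) (D (suc p)) Lμ i)
        (trans (sym (shift-+ E (t * suc p) (D (suc p) ⊛ Lμ) n))
          (cong (λ e → shift e (D (suc p) ⊛ Lμ) n)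
            (solve 6 (λ Q p m K x t → (Q :+ p :* (m :* K :+ x)) :+ t :* p := Q :+ p :* (m :* K :+ (x :+ t))) refl
              (K * (suc p * p)) (suc p) m K x t)))
      right : shift E (D p ⊛ Lμ) n ≡ shift e (term D K x L (2 + m) p) n
      right = trans
        (cong₂ (λ e μ → shift e (D p ⊛ L μ) n) (exponents p)
          (solve 2 (λ m p → m :+ con 2 :* (con 1 :+ p) := (con 2 :+ m) :+ con 2 :* p) refl m p))
        (shift-+ e (weight K x (2 + m) p) (D p ⊛ L (2 + m + 2 * p)) n)
        where
        exponents : ∀ p → weight K x m (suc p) ≡ m * K + x + weight K x (2 + m) p
        exponents zero    = solve 3 (λ m K x → K :* con 0 :+ (con 1 :* (m :* K :+ x)) := m :* K :+ x :+ (K :* con 0 :+ con 0)) refl m K x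
        exponents (suc p) = solve 4 (λ p m K x →
          K :* ((con 2 :+ p) :* (con 1 :+ p)) :+ (con 2 :+ p) :* (m :* K :+ x)
            := m :* K :+ x :+ (K :* ((con 1 :+ p) :* p) :+ (con 1 :+ p) :* ((con 2 :+ m) :* K :+ x))) refl p m K x

layer-0# : ∀ D K x L m → (∀ μ n → L μ n ≡ 0) → ∀ n → layer D K x L m n ≡ 0
layer-0# D K x L m h n = ∑-zero (2 + n) λ p _ → trans
  (shift-cong (weight K x m p) n λ i _ → trans (⊛-congʳ (D p) i λ i _ → h (m + 2 * p) i) (⊛-zeroʳ (D p) i))
  (shift-0# (weight K x m p) n)

-- A term with p ≥ 1 has weight at least m, so only p = 0 is seen in degrees below m.
layer-low : ∀ D k x L m → D 0 ≡ one → (∀ {n} → n < m → L m n ≡ one n) → ∀ {n} → n < m → layer D (suc k) x L m n ≡ one n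
layer-low D k x L m D₀ h {n} n<m = trans (cong₂ _+_
    (trans (cong₂ (λ A e → shift e (A ⊛ L (m + 0)) n) D₀ (trans (+-identityʳ _) (*-zeroʳ (suc k))))
      (trans (⊛-identityˡ (L (m + 0)) n) (trans (cong (λ μ → L μ n) (+-identityʳ m)) (h n<m))))
    (∑-zero (suc n) λ p _ → shift-below (D (suc p) ⊛ L (m + 2 * suc p)) (<-≤-trans n<m (m≤weight p))))
  (+-identityʳ (one n))
  where
  m≤weight : ∀ p → m ≤ weight (suc k) x m (suc p)
  m≤weight p = ≤-trans (≤-trans (m≤m*n m (suc k)) (m≤m+n _ x)) (≤-trans (m≤n*m (m * suc k + x) (suc p)) (m≤n+m (suc p * (m * suc k + x)) (suc k * (suc p * p))))

-- The multisums with denominator (q)_{s_k}.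

-- With w = k − j:  M k w r m = Σ_s q^{s_1²+⋯+s_k²−s_1−⋯−s_j+s_{k−r+1}+⋯+s_k+m(s_1+⋯+s_k)} / (q)_{s_1−s_2}⋯(q)_{s_k},
-- extended by M k (suc k) r m = 0.
M : ℕ → ℕ → ℕ → ℕ → Series
M zero    zero    r m = one
M zero    (suc w) r m = 0#
M (suc k) w       r m = layer invPoch (suc k) (w + r) (M k (w ∸ 1) (r ∸ 1)) m

-- The index w = k+1 stands for j = -1, where no value of f_0 is left. The zero series at k = 0
-- passes through every layer.
M-beyond : ∀ k r m n → M k (suc k) r m n ≡ 0
M-beyond zero    r m n = refl
M-beyond (suc k) r m n = layer-0# invPoch (suc k) (2 + k + r) (M k (suc k) (r ∸ 1)) m (M-beyond k (r ∸ 1)) n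

M-low : ∀ k {w} r m {n} → w ≤ k → n < m → M k w r m n ≡ one n
M-low zero    {zero} r m _ _ = refl
M-low (suc k) {w} r m w≤k n<m =
  layer-low invPoch k (w + r) (M k (w ∸ 1) (r ∸ 1)) m refl (M-low k (r ∸ 1) m (∸-monoˡ-≤ 1 w≤k)) n<m

-- From the two-step recurrence to the one-step recurrence.

-- The multisums yield the two-step recurrence, frequency sequences the one-step recurrence. The defect Δ_w(m) of the latter
-- satisfies Δ_w(m) = −q^{mu} Δ_u(m+1) and vanishes in degrees below m, hence is zero.
module TwoStep (k : ℕ) (H : ℕ → ℕ → Series) (Good : ℕ → ℕ → Set)
  (Good-flip : ∀ {u w m} → u + w ≡ suc k → Good w m → Good u (suc m))
  (beyond : ∀ m n → H (2 + k) m n ≡ 0)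
  (low : ∀ {w m n} → w ≤ suc k → n < m → H w m n ≡ one n)
  (two-step : ∀ {u w m} → u + w ≡ suc k → Good w m → ∀ n →
    H w m n ≡ H (suc w) m n + shift (m * u) (H (suc u) (suc m)) n + shift (m * suc k + w) (H w (2 + m)) n)
  where

  private
    -- Here d measures how far the degree reaches beyond m. The recursive call concerns u at m+1,
    -- for which `n < m + suc d` reads `n < suc m + d`; in degrees below m both sides are explicit.
    step : ∀ d {u w m} → u + w ≡ suc k → Good w m → ∀ n → n < m + d →
      H w m n ≡ H (suc w) m n + shift (m * u) (H u (suc m)) n
    -- For u = 0 the term with `suc w` vanishes by `beyond`, and the other one, unshifted, supplies
    -- the coefficient of 1. For u ≥ 1 it is the reverse: the shift by m·u ≥ m removes the second
    -- term.
    step zero {zero} {w} {m} refl _ n n<m+0 = trans (low ≤-refl n<m) (sym (cong₂ _+_ (beyond m n)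
        (trans (cong (λ e → shift e (H 0 (suc m)) n) (*-zeroʳ m)) (low z≤n (m<n⇒m<1+n n<m)))))
      where n<m = subst (n <_) (+-identityʳ m) n<m+0
    step zero {suc u} {w} {m} u+w _ n n<m+0 = trans (low (w≤1+k) n<m) (sym (trans
        (cong₂ _+_ (low (≤-trans (m≤n+m (suc w) u) (≤-reflexive (trans (+-suc u w) u+w))) n<m)
          (shift-below (H (suc u) (suc m)) (<-≤-trans n<m (m≤m*n m (suc u)))))
        (+-identityʳ (one n))))
      where
      n<m = subst (n <_) (+-identityʳ m) n<m+0
      w≤1+k : w ≤ suc k
      w≤1+k = ≤-trans (m≤n+m w (suc u)) (≤-reflexive u+w)
    step (suc d) {u} {w} {m} u+w good n n<m = begin
      H w m n
        ≡⟨ two-step u+w good n ⟩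
      H (suc w) m n + shift (m * u) (H (suc u) (suc m)) n + shift (m * suc k + w) (H w (2 + m)) n
        ≡⟨ +-assoc (H (suc w) m n) _ _ ⟩
      H (suc w) m n + (shift (m * u) (H (suc u) (suc m)) n + shift (m * suc k + w) (H w (2 + m)) n)
        -- As K = u + w, the exponent mK + w equals mu + (m+1)w. The last two terms are thus q^{mu}
        -- times the right-hand side of the one-step recurrence for u at m+1.
        ≡⟨ cong (λ e → H (suc w) m n + (shift (m * u) (H (suc u) (suc m)) n + e)) (trans
             (cong (λ e → shift e (H w (2 + m)) n) (trans (cong (λ K → m * K + w) (sym u+w))
               (solve 3 (λ u w m → m :* (u :+ w) :+ w := m :* u :+ (con 1 :+ m) :* w) refl u w m)))
             (shift-+ (m * u) (suc m * w) (H w (2 + m)) n)) ⟩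
      H (suc w) m n + (shift (m * u) (H (suc u) (suc m)) n + shift (m * u) (shift (suc m * w) (H w (2 + m))) n)
        ≡⟨ cong (H (suc w) m n +_) (shift-⊕ (m * u) (H (suc u) (suc m)) (shift (suc m * w) (H w (2 + m))) n) ⟨
      H (suc w) m n + shift (m * u) (H (suc u) (suc m) ⊕ shift (suc m * w) (H w (2 + m))) n
        ≡⟨ cong (H (suc w) m n +_) (shift-cong (m * u) n λ i i≤n →
             step d (trans (+-comm w u) u+w) (Good-flip u+w good) i
               (≤-<-trans (≤-trans (m≤n+m i (m * u)) i≤n) (subst (n <_) (+-suc m d) n<m))) ⟨
      H (suc w) m n + shift (m * u) (H u (suc m)) n ∎
      where open ≡-Reasoning

  one-step : ∀ {u w m} → u + w ≡ suc k → Good w m → ∀ n →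
    H w m n ≡ H (suc w) m n + shift (m * u) (H u (suc m)) n
  one-step {m = m} u+w good n = step (suc n) u+w good n (m≤n+m (suc n) m)

-- The recurrence for the multisums, by induction on k.

-- For r ≥ 1 one has w + r = (w+1) + (r-1), so splitting the layer yields both terms directly. For r
-- = 0 the index `r ∸ 1` stays 0 and the coefficient is one short; peeling with t = 1 supplies it,
-- at the cost of a term at m+2 that `TwoStep` eliminates.
M-step : ∀ k {j w r} m → j + w ≡ k → r ≤ w → ∀ n →
  M k w r m n ≡ M k (suc w) (r ∸ 1) m n + shift (m * j) (M k (r + j) 0 (suc m)) n

-- For w = 0 the value j = k+1 lies outside the range of `M-step`; truncation makes the first term
-- equal to the left-hand side, and the second vanishes by `M-beyond`.
M-step-below : ∀ k {j w r} → j + w ≡ suc k → r ≤ w → ∀ m n →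
  M k (w ∸ 1) (r ∸ 1) m n ≡ M k w (r ∸ 1 ∸ 1) m n + shift (m * j) (M k (r ∸ 1 + j) 0 (suc m)) n
M-step-below k {j} {zero} {zero} j+w z≤n m n = sym (trans
  (cong (M k 0 0 m n +_) (trans
    (shift-cong (m * j) n λ i _ → trans (cong (λ j → M k j 0 (suc m) i) (trans (sym (+-identityʳ j)) j+w)) (M-beyond k 0 (suc m) i))
    (shift-0# (m * j) n)))
  (+-identityʳ (M k 0 0 m n)))
M-step-below k {j} {suc w} {r} j+w r≤w m n =
  M-step k {j} {w} {r ∸ 1} m (suc-injective (trans (sym (+-suc j w)) j+w)) (∸-monoˡ-≤ 1 r≤w) n

M-step zero {zero} {zero} {zero} m _ _ n = cong (λ e → shift e one n) (sym (*-zeroʳ m))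
M-step (suc k) {j} {w} {zero} m j+w _ n = TwoStep.one-step k (λ w → M (suc k) w 0) (λ _ _ → ⊤) (λ _ _ → tt)
    (M-beyond (suc k) 0) (λ {w} {m} → M-low (suc k) 0 m) (λ {u} {w} {m} u+w _ → two-step u w m u+w) j+w tt n
  where
  two-step : ∀ u w m → u + w ≡ suc k → ∀ n → M (suc k) w 0 m n ≡
    M (suc k) (suc w) 0 m n + shift (m * u) (M (suc k) (suc u) 0 (suc m)) n + shift (m * suc k + w) (M (suc k) w 0 (2 + m)) n
  two-step u w m u+w n = trans
    (layer-peel invPoch k {x = w + 0} (M k (w ∸ 1) 0) m invPoch-isInverse n)
    (cong₂ _+_
      (trans
        (layer-split invPoch k (M k (w ∸ 1) 0) (M k w 0) (M k u 0) m exponents (M-step-below k u+w z≤n) n)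
        (cong (λ x → layer invPoch (suc k) x (M k w 0) m n + shift (m * u) (M (suc k) (suc u) 0 (suc m)) n) (+-comm (w + 0) 1)))
      (cong (λ x → shift (m * suc k + x) (M (suc k) w 0 (2 + m)) n) (+-identityʳ w)))
    where
    exponents : suc k + (suc u + 0) ≡ w + 0 + 1 + 2 * u
    exponents = trans (cong (_+ (suc u + 0)) (sym u+w))
      (solve 2 (λ u w → (u :+ w) :+ (con 1 :+ u :+ con 0) := w :+ con 0 :+ con 1 :+ con 2 :* u) refl u w)
M-step (suc k) {j} {w} {suc r} m j+w r≤w n = trans
  (layer-split invPoch k (M k (w ∸ 1) r) (M k w (r ∸ 1)) (M k (r + j) 0) m exponents (M-step-below k j+w r≤w) n)
  (cong₂ (λ x y → layer invPoch (suc k) x (M k w (r ∸ 1)) m n + shift (m * j) (layer invPoch (suc k) y (M k (r + j) 0) (suc m)) n)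
    (+-suc w r) refl)
  where
  exponents : suc k + (suc r + j + 0) ≡ w + suc r + 2 * j
  exponents = trans (cong (_+ (suc r + j + 0)) (sym j+w))
    (solve 3 (λ j w r → (j :+ w) :+ (con 1 :+ r :+ j :+ con 0) := w :+ (con 1 :+ r) :+ con 2 :* j) refl j w r)

-- Parity, and the multisums with denominator (q²;q²)_{s_k}.

%2-cases : ∀ n → n % 2 ≡ 0 ⊎ n % 2 ≡ 1
%2-cases zero          = inj₁ refl
%2-cases (suc zero)    = inj₂ refl
%2-cases (suc (suc n)) = %2-cases n

suc-%2 : ∀ n {a} → n % 2 ≡ a → suc n % 2 ≡ suc a % 2
suc-%2 zero          refl = refl
suc-%2 (suc zero)    refl = refl
suc-%2 (suc (suc n)) eq   = suc-%2 n eq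

%2-shift : ∀ {a b} c → a ≡ b + c * 2 → a % 2 ≡ b % 2
%2-shift {b = b} c refl = [m+kn]%n≡m%n b c 2

-- H w m is the claimed generating function of sequences f_m, f_{m+1}, … with f_m + w ≤ K = k + 1, whose entries at
-- distance one add up to at most K and satisfy i f_i + (i+1) f_{i+1} ≡ c whenever that sum is K.
-- If f_m = u and u + w = K, then f_{m+1} = w is admissible precisely when δ w m = 0.
module Bressoud (c k : ℕ) where

  private
    K = suc k

  δ : ℕ → ℕ → ℕ
  δ w m = (c + m * K + w) % 2

  H : ℕ → ℕ → Series
  H w m = layer invPoch2 K (w + δ w m) (M k (w ∸ 1) 0) m

  H-beyond : ∀ m n → H (suc K) m n ≡ 0
  H-beyond m = layer-0# invPoch2 K (suc K + δ (suc K) m) (M k K 0) m (M-beyond k 0)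

  H-low : ∀ {w m n} → w ≤ K → n < m → H w m n ≡ one n
  H-low {w} {m} w≤K = layer-low invPoch2 k (w + δ w m) (M k (w ∸ 1) 0) m refl (M-low k 0 m (∸-monoˡ-≤ 1 w≤K))

  module _ {u w : ℕ} (m : ℕ) (u+w : u + w ≡ K) where

    δ-flip : δ u (suc m) ≡ δ w m
    δ-flip = %2-shift u (subst (λ K → c + suc m * K + u ≡ c + m * K + w + u * 2) u+w
      (solve 4 (λ c m u w → c :+ (con 1 :+ m) :* (u :+ w) :+ u := c :+ m :* (u :+ w) :+ w :+ u :* con 2) refl c m u w))

    δ-suc-flip : ∀ {a} → δ w m ≡ a → δ (suc u) (suc m) ≡ suc a % 2
    δ-suc-flip eq = trans (cong (_% 2) (+-suc (c + suc m * K) u)) (suc-%2 (c + suc m * K + u) (trans δ-flip eq))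

  δ-suc : ∀ w m {a} → δ w m ≡ a → δ (suc w) m ≡ suc a % 2
  δ-suc w m eq = trans (cong (_% 2) (+-suc (c + m * K) w)) (suc-%2 (c + m * K + w) eq)

  H-≡ : ∀ w m {d} → δ w m ≡ d → H w m ≡ layer invPoch2 K (w + d) (M k (w ∸ 1) 0) m
  H-≡ w m refl = refl

  -- The balance of exponents leads to w+1 at m and u+1 at m+1, and by parity both carry the same δ,
  -- namely a. The case a = 0 is the recurrence for δ = 1; the case a = 1 is used after peeling when
  -- δ = 0.
  H-split : ∀ {u w m} a → u + w ≡ K → δ (suc w) m ≡ a → δ (suc u) (suc m) ≡ a → ∀ n →
    layer invPoch2 K (w + suc a) (M k (w ∸ 1) 0) m n ≡ H (suc w) m n + shift (m * u) (H (suc u) (suc m)) n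
  H-split {u} {w} {m} a u+w δw δu n = begin
    layer invPoch2 K (w + suc a) (M k (w ∸ 1) 0) m n
      ≡⟨ layer-split invPoch2 k (M k (w ∸ 1) 0) (M k w 0) (M k u 0) m exponents (M-step-below k u+w z≤n) n ⟩
    layer invPoch2 K (w + suc a) (M k w 0) m n + shift (m * u) (layer invPoch2 K (suc u + a) (M k u 0) (suc m)) n
      ≡⟨ cong₂ _+_ (trans (cong (λ A → A n) (H-≡ (suc w) m δw)) (cong (λ x → layer invPoch2 K x (M k w 0) m n) (sym (+-suc w a))))
           (cong (λ A → shift (m * u) A n) (H-≡ (suc u) (suc m) δu)) ⟨
    H (suc w) m n + shift (m * u) (H (suc u) (suc m)) n ∎
    where
    open ≡-Reasoning
    exponents : K + (suc u + a) ≡ w + suc a + 2 * u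
    exponents = trans (cong (_+ (suc u + a)) (sym u+w))
      (solve 3 (λ u w a → (u :+ w) :+ (con 1 :+ u :+ a) := w :+ (con 1 :+ a) :+ con 2 :* u) refl u w a)

  -- Peeling with t = 2 raises the coefficient w to w+2, which is where `H-split` with a = 1
  -- applies. The peeled term stays of the same kind because δ has period two in m.
  H-two-step : ∀ {u w m} → u + w ≡ K → δ w m ≡ 0 → ∀ n →
    H w m n ≡ H (suc w) m n + shift (m * u) (H (suc u) (suc m)) n + shift (m * K + w) (H w (2 + m)) n
  H-two-step {u} {w} {m} u+w even n = begin
    H w m n
      ≡⟨ cong (λ A → A n) (H-≡ w m even) ⟩
    layer invPoch2 K (w + 0) L m n
      ≡⟨ layer-peel invPoch2 k {x = w + 0} L m invPoch2-isInverse n ⟩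
    layer invPoch2 K (w + 0 + 2) L m n + shift (m * K + (w + 0)) (layer invPoch2 K (w + 0) L (2 + m)) n
      ≡⟨ cong₂ _+_
           (trans (cong (λ x → layer invPoch2 K (x + 2) L m n) (+-identityʳ w))
             (H-split 1 u+w (δ-suc w m even) (δ-suc-flip m u+w even) n))
           (trans (cong (λ x → shift (m * K + x) (layer invPoch2 K (w + 0) L (2 + m)) n) (+-identityʳ w))
             (cong (λ A → shift (m * K + w) A n) (sym (H-≡ w (2 + m) (trans δ-period even))))) ⟩
    H (suc w) m n + shift (m * u) (H (suc u) (suc m)) n + shift (m * K + w) (H w (2 + m)) n ∎
    where
    open ≡-Reasoning
    L = M k (w ∸ 1) 0
    δ-period : δ w (2 + m) ≡ δ w m
    δ-period = %2-shift K (solve 4 (λ c m K w → c :+ (con 2 :+ m) :* K :+ w := c :+ m :* K :+ w :+ K :* con 2) refl c m K w)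

  -- The last term collects the sequences with f_m = u = K - w. If δ = 0, the value f_{m+1} = w is
  -- allowed and the next bound is u; if δ = 1, it is excluded and the next bound is u+1.
  H-step : ∀ {u w} m → u + w ≡ K → ∀ n → H w m n ≡ H (suc w) m n + shift (m * u) (H (δ w m + u) (suc m)) n
  H-step {u} {w} m u+w n with %2-cases (c + m * K + w)
  ... | inj₁ even = trans
    (TwoStep.one-step k H (λ w m → δ w m ≡ 0) (λ {u} {w} {m} u+w → trans (δ-flip m u+w)) H-beyond H-low H-two-step u+w even n)
    (cong (λ d → H (suc w) m n + shift (m * u) (H (d + u) (suc m)) n) (sym even))
  ... | inj₂ odd = trans (cong (λ A → A n) (H-≡ w m odd)) (trans
    (H-split 0 u+w (δ-suc w m odd) (δ-suc-flip m u+w odd) n)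
    (cong (λ d → H (suc w) m n + shift (m * u) (H (d + u) (suc m)) n) (sym odd)))

  -- `H-step` telescopes in w up to K+1, where `H` is zero.
  H-sum : ∀ v {w} m n → v + w ≡ suc K →
    ∑ v (λ u → shift (m * u) (H (δ (K ∸ u) m + u) (suc m)) n) ≡ H w m n
  H-sum zero    {w} m n refl = sym (H-beyond m n)
  H-sum (suc v) {w} m n v+w  = begin
    ∑ (suc v) (λ u → shift (m * u) (H (δ (K ∸ u) m + u) (suc m)) n)
      ≡⟨ ∑-last v (λ u → shift (m * u) (H (δ (K ∸ u) m + u) (suc m)) n) ⟩
    ∑ v (λ u → shift (m * u) (H (δ (K ∸ u) m + u) (suc m)) n) + shift (m * v) (H (δ (K ∸ v) m + v) (suc m)) n
      ≡⟨ cong₂ _+_ (H-sum v {suc w} m n (trans (+-suc v w) v+w))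
           (cong (λ w → shift (m * v) (H (δ w m + v) (suc m)) n) (trans (cong (_∸ v) (sym (suc-injective v+w))) (m+n∸m≡n v w))) ⟩
    H (suc w) m n + shift (m * v) (H (δ w m + v) (suc m)) n
      ≡⟨ H-step m (suc-injective v+w) n ⟨
    H w m n ∎
    where open ≡-Reasoning

-- Sums over decreasing tuples.

∑↘ : ℕ → ℕ → (List ℕ → ℕ) → ℕ
∑↘ zero    b g = g []
∑↘ (suc k) b g = ∑ (suc b) (λ x → ∑↘ k x (λ s → g (x ∷ s)))

∑↘-cong : ∀ k b {g h : List ℕ → ℕ} → (∀ s → length s ≡ k → g s ≡ h s) → ∑↘ k b g ≡ ∑↘ k b h
∑↘-cong zero    b eq = eq [] refl
∑↘-cong (suc k) b eq = ∑-cong (suc b) λ x _ → ∑↘-cong k x λ s len → eq (x ∷ s) (cong suc len)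

∑↘-shift : ∀ e k b (F : List ℕ → Series) n → shift e (λ i → ∑↘ k b (λ s → F s i)) n ≡ ∑↘ k b (λ s → shift e (F s) n)
∑↘-shift e zero    b F n = refl
∑↘-shift e (suc k) b F n = trans (shift-∑ e (suc b) (λ x i → ∑↘ k x (λ s → F (x ∷ s) i)) n)
  (∑-cong (suc b) λ x _ → ∑↘-shift e k x (λ s → F (x ∷ s)) n)

∑↘-⊛ : ∀ A k b (F : List ℕ → Series) n → (A ⊛ (λ i → ∑↘ k b (λ s → F s i))) n ≡ ∑↘ k b (λ s → (A ⊛ F s) n)
∑↘-⊛ A zero    b F n = refl
∑↘-⊛ A (suc k) b F n = trans (⊛-distribˡ-∑ A (suc b) (λ x i → ∑↘ k x (λ s → F (x ∷ s) i)) n)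
  (∑-cong (suc b) λ x _ → ∑↘-⊛ A k x (λ s → F (x ∷ s)) n)

sum-map-concatMap : ∀ {X Y : Set} (h : Y → ℕ) (f : X → List Y) xs →
  sum (map h (concatMap f xs)) ≡ sum (map (λ x → sum (map h (f x))) xs)
sum-map-concatMap h f []       = refl
sum-map-concatMap h f (x ∷ xs) = trans (cong sum (map-++ h (f x) (concatMap f xs)))
  (trans (sum-++ (map h (f x)) _) (cong (sum (map h (f x)) +_) (sum-map-concatMap h f xs)))

sum-box : ∀ k N (h : List ℕ → ℕ) →
  sum (map h (box (suc k) N)) ≡ ∑ (suc N) (λ x → sum (map (λ s → h (x ∷ s)) (box k N)))
sum-box k N h = begin
  sum (map h (concatMap (λ x → map (x ∷_) (box k N)) (upTo (suc N))))
    ≡⟨ sum-map-concatMap h (λ x → map (x ∷_) (box k N)) (upTo (suc N)) ⟩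
  sum (map (λ x → sum (map h (map (x ∷_) (box k N)))) (upTo (suc N)))
    ≡⟨ sum-map-upTo (λ x → sum (map h (map (x ∷_) (box k N)))) (suc N) ⟩
  ∑ (suc N) (λ x → sum (map h (map (x ∷_) (box k N))))
    ≡⟨ ∑-cong (suc N) (λ x _ → cong sum (sym (map-∘ {g = h} {f = x ∷_} (box k N)))) ⟩
  ∑ (suc N) (λ x → sum (map (λ s → h (x ∷ s)) (box k N))) ∎
  where open ≡-Reasoning

sum-map-zero : ∀ {X : Set} (xs : List X) → sum (map (λ _ → 0) xs) ≡ 0
sum-map-zero []       = refl
sum-map-zero (x ∷ xs) = sum-map-zero xs

sum-box-decreasing : ∀ k {b N} (g : List ℕ → ℕ) → b ≤ N →
  sum (map (λ s → if decreasing (b ∷ s) then g s else 0) (box k N)) ≡ ∑↘ k b g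
sum-box-decreasing zero    g b≤N = +-identityʳ (g [])
sum-box-decreasing (suc k) {b} {N} g b≤N = begin
  sum (map (λ s → if decreasing (b ∷ s) then g s else 0) (box (suc k) N))
    ≡⟨ sum-box k N (λ s → if decreasing (b ∷ s) then g s else 0) ⟩
  ∑ (suc N) (λ y → sum (map (λ s → if (y ≤ᵇ b) ∧ decreasing (y ∷ s) then g (y ∷ s) else 0) (box k N)))
    ≡⟨ ∑-truncate (s≤s b≤N) (λ y b<y → trans
         (cong (λ a → sum (map (λ s → if a ∧ decreasing (y ∷ s) then g (y ∷ s) else 0) (box k N))) (dec-false (y ≤? b) (<⇒≱ b<y)))
         (sum-map-zero (box k N))) ⟩
  ∑ (suc b) (λ y → sum (map (λ s → if (y ≤ᵇ b) ∧ decreasing (y ∷ s) then g (y ∷ s) else 0) (box k N)))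
    ≡⟨ ∑-cong (suc b) (λ y y≤b → trans
         (cong (λ a → sum (map (λ s → if a ∧ decreasing (y ∷ s) then g (y ∷ s) else 0) (box k N))) (dec-true (y ≤? b) (s≤s⁻¹ y≤b)))
         (sum-box-decreasing k (λ s → g (y ∷ s)) (≤-trans (s≤s⁻¹ y≤b) b≤N))) ⟩
  ∑↘ (suc k) b g ∎
  where open ≡-Reasoning

sum-decreasing : ∀ k N (g : List ℕ → ℕ) →
  sum (map (λ s → if decreasing s then g s else 0) (box (suc k) N)) ≡ ∑↘ (suc k) N g
sum-decreasing k N g = trans (sum-box k N (λ s → if decreasing s then g s else 0))
  (∑-cong (suc N) λ x x≤N → sum-box-decreasing k (λ s → g (x ∷ s)) (s≤s⁻¹ x≤N))

∑-triangle′ : ∀ N (F : ℕ → ℕ → ℕ) →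
  ∑ N (λ x → ∑ (suc x) (F x)) ≡ ∑ N (λ p → ∑ (N ∸ p) (λ y → F (p + y) p))
∑-triangle′ zero    F = refl
∑-triangle′ (suc N) F = trans (∑-+ (suc N) (λ x → F x 0) (λ x → ∑ x (λ p → F x (suc p))))
  (cong (∑ (suc N) (λ x → F x 0) +_) (∑-triangle′ N (λ x p → F (suc x) (suc p))))

raise : ℕ → List ℕ → List ℕ
raise p t = map (p +_) t ++ p ∷ []

-- A decreasing s determines its last entry p and a decreasing t with entries at most b - p such
-- that s = `raise p t`. The induction moves the choice of p outwards past one variable at a time.
∑↘-last : ∀ k b g → ∑↘ (suc k) b g ≡ ∑ (suc b) (λ p → ∑↘ k (b ∸ p) (λ t → g (raise p t)))
∑↘-last zero    b g = refl
∑↘-last (suc k) b g = begin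
  ∑ (suc b) (λ x → ∑↘ (suc k) x (λ s → g (x ∷ s)))
    ≡⟨ ∑-cong (suc b) (λ x _ → ∑↘-last k x (λ s → g (x ∷ s))) ⟩
  ∑ (suc b) (λ x → ∑ (suc x) (λ p → ∑↘ k (x ∸ p) (λ t → g (x ∷ raise p t))))
    ≡⟨ ∑-triangle′ (suc b) (λ x p → ∑↘ k (x ∸ p) (λ t → g (x ∷ raise p t))) ⟩
  ∑ (suc b) (λ p → ∑ (suc b ∸ p) (λ y → ∑↘ k (p + y ∸ p) (λ t → g ((p + y) ∷ raise p t))))
    ≡⟨ ∑-cong (suc b) (λ p p≤b → cong (λ N → ∑ N (λ y → ∑↘ k (p + y ∸ p) (λ t → g ((p + y) ∷ raise p t)))) (+-∸-assoc 1 (s≤s⁻¹ p≤b))) ⟩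
  ∑ (suc b) (λ p → ∑ (suc (b ∸ p)) (λ y → ∑↘ k (p + y ∸ p) (λ t → g ((p + y) ∷ raise p t))))
    ≡⟨ ∑-cong (suc b) (λ p _ → ∑-cong (suc (b ∸ p)) λ y _ →
         cong (λ z → ∑↘ k z (λ t → g ((p + y) ∷ raise p t))) (m+n∸m≡n p y)) ⟩
  ∑ (suc b) (λ p → ∑↘ (suc k) (b ∸ p) (λ t → g (raise p t))) ∎
  where open ≡-Reasoning

-- Exponents and denominators under s_i = t_i + p.

-- The exponent of q in M k w r m; s_1²+⋯+s_k²−s_1−⋯−s_j is written as Σ_i s_i(s_i−1) + s_{j+1}+⋯+s_k with j = k − w.
exponent : ℕ → ℕ → ℕ → ℕ → List ℕ → ℕ
exponent m w r k s = sum (map (λ x → x * (x ∸ 1)) s) + m * sum s + sum (drop (k ∸ w) s) + sum (drop (k ∸ r) s)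

sum-raise : ∀ p t → sum (raise p t) ≡ suc (length t) * p + sum t
sum-raise p []      = sym (+-identityʳ (p + 0))
sum-raise p (x ∷ t) = trans (cong (p + x +_) (sum-raise p t))
  (solve 4 (λ p x l s → p :+ x :+ (l :+ s) := p :+ l :+ (x :+ s)) refl p x (suc (length t) * p) (sum t))

sum-pronic-raise : ∀ p t → sum (map (λ x → x * (x ∸ 1)) (raise p t)) ≡
  suc (length t) * (p * (p ∸ 1)) + 2 * p * sum t + sum (map (λ x → x * (x ∸ 1)) t)
sum-pronic-raise p [] = solve 2 (λ a p → a :+ con 0 := a :+ con 0 :+ con 2 :* p :* con 0 :+ con 0) refl (p * (p ∸ 1)) p
sum-pronic-raise p (x ∷ t) = trans (cong₂ _+_ (pronic-+ p x) (sum-pronic-raise p t))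
  (solve 7 (λ a p x q l s t → (a :+ con 2 :* p :* x :+ q) :+ (l :+ con 2 :* p :* s :+ t)
      := (a :+ l) :+ con 2 :* p :* (x :+ s) :+ (q :+ t)) refl
    (p * (p ∸ 1)) p x (x * (x ∸ 1)) (suc (length t) * (p * (p ∸ 1))) (sum t) (sum (map (λ x → x * (x ∸ 1)) t)))
  where
  pronic-+ : ∀ p x → (p + x) * (p + x ∸ 1) ≡ p * (p ∸ 1) + 2 * p * x + x * (x ∸ 1)
  pronic-+ zero    x       = refl
  pronic-+ (suc p) zero    = solve 1 (λ p → (con 1 :+ p :+ con 0) :* (p :+ con 0) :=
    (con 1 :+ p) :* p :+ con 2 :* (con 1 :+ p) :* con 0 :+ con 0) refl p
  pronic-+ (suc p) (suc x) = solve 2 (λ p x → (con 1 :+ p :+ (con 1 :+ x)) :* (p :+ (con 1 :+ x)) :=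
    (con 1 :+ p) :* p :+ con 2 :* (con 1 :+ p) :* (con 1 :+ x) :+ (con 1 :+ x) :* x) refl p x

-- The last w entries of `raise p t` are p and the last w-1 entries of t raised by p. For w = 0 both
-- tails are empty, so the truncation in `w ∸ 1` does no harm.
sum-drop-raise : ∀ p t {w} → w ≤ suc (length t) →
  sum (drop (suc (length t) ∸ w) (raise p t)) ≡ p * w + sum (drop (length t ∸ (w ∸ 1)) t)
sum-drop-raise p []      {zero}     _ = sym (trans (+-identityʳ (p * 0)) (*-zeroʳ p))
sum-drop-raise p []      {suc zero} _ = solve 1 (λ p → p :+ con 0 := p :* con 1 :+ con 0) refl p
sum-drop-raise p []      {suc (suc w)} (s≤s ())
sum-drop-raise p (x ∷ t) {w} w≤ with m≤n⇒m<n∨m≡n w≤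
... | inj₂ refl = trans
  (cong (λ i → sum (drop i (raise p (x ∷ t)))) (n∸n≡0 (suc (suc (length t)))))
  (trans (sum-raise p (x ∷ t)) (cong₂ _+_ (*-comm (suc (suc (length t))) p)
    (cong (λ i → sum (drop i (x ∷ t))) (sym (n∸n≡0 (suc (length t)))))))
... | inj₁ (s≤s w≤l) = trans
  (cong (λ i → sum (drop i (raise p (x ∷ t)))) (+-∸-assoc 1 w≤l))
  (trans (sum-drop-raise p t w≤l) (cong (p * w +_) (drop-suc w≤l)))
  where
  drop-suc : ∀ {w} → w ≤ suc (length t) →
    sum (drop (length t ∸ (w ∸ 1)) t) ≡ sum (drop (suc (length t) ∸ (w ∸ 1)) (x ∷ t))
  drop-suc {zero}  _         = refl
  drop-suc {suc w} (s≤s w≤l) = cong (λ i → sum (drop i (x ∷ t))) (sym (+-∸-assoc 1 w≤l))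

exponent-raise : ∀ m {w r} p t → w ≤ suc (length t) → r ≤ suc (length t) →
  exponent m w r (suc (length t)) (raise p t) ≡
  weight (suc (length t)) (w + r) m p + exponent (m + 2 * p) (w ∸ 1) (r ∸ 1) (length t) t
exponent-raise m {w} {r} p t w≤ r≤ = trans
  (cong₂ _+_ (cong₂ _+_ (cong₂ _+_ (sum-pronic-raise p t) (cong (m *_) (sum-raise p t)))
    (sum-drop-raise p t w≤)) (sum-drop-raise p t r≤))
  (solve 10 (λ K a p S Q m w dw r dr →
      K :* a :+ con 2 :* p :* S :+ Q :+ m :* (K :* p :+ S) :+ (p :* w :+ dw) :+ (p :* r :+ dr)
      := K :* a :+ p :* (m :* K :+ (w :+ r)) :+ (Q :+ (m :+ con 2 :* p) :* S :+ dw :+ dr)) refl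
    (suc (length t)) (p * (p ∸ 1)) p (sum t) (sum (map (λ x → x * (x ∸ 1)) t)) m
    w (sum (drop (length t ∸ (w ∸ 1)) t)) r (sum (drop (length t ∸ (r ∸ 1)) t)))

-- Writing s² = s(s-1) + s makes the subtraction exact: the linear parts of the first j entries
-- cancel, and those of the remaining entries form the `drop` term.
expo-exponent : ∀ {j} r {k} s → j ≤ k → expo j r k s ≡ exponent 0 (k ∸ j) r k s + 1 * lastOr0 s
expo-exponent {j} r {k} s j≤k = begin
  sum (map (λ x → x * x) s) + R + lastOr0 s ∸ sum (take j s)
    ≡⟨ cong (λ z → z + R + lastOr0 s ∸ sum (take j s)) (sum-squares s) ⟩
  Q + sum s + R + lastOr0 s ∸ sum (take j s)
    ≡⟨ cong (λ z → Q + z + R + lastOr0 s ∸ sum (take j s)) (trans (cong sum (sym (take++drop≡id j s))) (sum-++ (take j s) (drop j s))) ⟩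
  Q + (sum (take j s) + sum (drop j s)) + R + lastOr0 s ∸ sum (take j s)
    ≡⟨ cong (_∸ sum (take j s)) (solve 5 (λ Q T D R l → Q :+ (T :+ D) :+ R :+ l := T :+ (Q :+ con 0 :+ D :+ R :+ con 1 :* l)) refl
         Q (sum (take j s)) (sum (drop j s)) R (lastOr0 s)) ⟩
  sum (take j s) + (Q + 0 + sum (drop j s) + R + 1 * lastOr0 s) ∸ sum (take j s)
    ≡⟨ m+n∸m≡n (sum (take j s)) _ ⟩
  Q + 0 + sum (drop j s) + R + 1 * lastOr0 s
    ≡⟨ cong (λ i → Q + 0 + sum (drop i s) + R + 1 * lastOr0 s) (sym (m∸[m∸n]≡n j≤k)) ⟩
  exponent 0 (k ∸ j) r k s + 1 * lastOr0 s ∎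
  where
  open ≡-Reasoning
  Q = sum (map (λ x → x * (x ∸ 1)) s)
  R = sum (drop (k ∸ r) s)
  square : ∀ x → x * x ≡ x * (x ∸ 1) + x
  square zero    = refl
  square (suc x) = solve 1 (λ x → (con 1 :+ x) :* (con 1 :+ x) := (con 1 :+ x) :* x :+ (con 1 :+ x)) refl x
  sum-squares : ∀ s → sum (map (λ x → x * x) s) ≡ sum (map (λ x → x * (x ∸ 1)) s) + sum s
  sum-squares []      = refl
  sum-squares (x ∷ s) = trans (cong₂ _+_ (square x) (sum-squares s))
    (solve 4 (λ a x b t → (a :+ x) :+ (b :+ t) := (a :+ b) :+ (x :+ t)) refl
      (x * (x ∸ 1)) x (sum (map (λ x → x * (x ∸ 1)) s)) (sum s))

lastOr0-raise : ∀ p t → lastOr0 (raise p t) ≡ p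
lastOr0-raise p []          = refl
lastOr0-raise p (x ∷ [])    = refl
lastOr0-raise p (x ∷ y ∷ t) = lastOr0-raise p (y ∷ t)

-- The factor of the last variable is a parameter, because `invPoch2` occurs only in the outermost
-- layer and all inner layers have `invPoch`.
denominator : (ℕ → Series) → List ℕ → Series
denominator D []          = one
denominator D (x ∷ [])    = D x
denominator D (x ∷ y ∷ s) = invPoch (x ∸ y) ⊛ denominator D (y ∷ s)

denInv-denominator : ∀ s n → denInv s n ≡ denominator invPoch2 s n
denInv-denominator []          n = refl
denInv-denominator (x ∷ [])    n = refl
denInv-denominator (x ∷ y ∷ s) n = ⊛-congʳ (invPoch (x ∸ y)) n λ i _ → denInv-denominator (y ∷ s) i

-- Differences are unchanged except that s_{k-1} - s_k is now the last entry of t. Its factor is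
-- `invPoch` whatever D is.
denominator-raise : ∀ D p t n → denominator D (raise p t) n ≡ (D p ⊛ denominator invPoch t) n
denominator-raise D p []       n = sym (⊛-identityʳ (D p) n)
denominator-raise D p (x ∷ []) n = trans (cong (λ d → (invPoch d ⊛ D p) n) (m+n∸m≡n p x)) (⊛-comm (invPoch x) (D p) n)
denominator-raise D p (x ∷ y ∷ t) n = begin
  (invPoch (p + x ∸ (p + y)) ⊛ denominator D (raise p (y ∷ t))) n
    ≡⟨ cong (λ d → (invPoch d ⊛ denominator D (raise p (y ∷ t))) n) ([m+n]∸[m+o]≡n∸o p x y) ⟩
  (invPoch (x ∸ y) ⊛ denominator D (raise p (y ∷ t))) n
    ≡⟨ ⊛-congʳ (invPoch (x ∸ y)) n (λ i _ → denominator-raise D p (y ∷ t) i) ⟩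
  (invPoch (x ∸ y) ⊛ (D p ⊛ denominator invPoch (y ∷ t))) n
    ≡⟨ ⊛-left-comm (invPoch (x ∸ y)) (D p) (denominator invPoch (y ∷ t)) n ⟩
  (D p ⊛ denominator invPoch (x ∷ y ∷ t)) n ∎
  where open ≡-Reasoning

-- The multisum as an iteration of layers.

-- An extra e·s_k only raises the coefficient x by e, as `raise p t` ends in p. The hypothesis on b
-- ensures that the cutoff s_1 ≤ b loses nothing in degree n.
∑↘-layer : ∀ D k {w r b} e m n → w ≤ suc k → r ≤ suc k → n + suc k ≤ b →
  ∑↘ (suc k) b (λ s → shift (exponent m w r (suc k) s + e * lastOr0 s) (denominator D s) n) ≡
  layer D (suc k) (w + r + e) (M k (w ∸ 1) (r ∸ 1)) m n

∑↘-M : ∀ k {w r b} m n → w ≤ k → r ≤ k → n + k ≤ b →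
  ∑↘ k b (λ s → shift (exponent m w r k s) (denominator invPoch s) n) ≡ M k w r m n

∑↘-layer D k {w} {r} {b} e m n w≤K r≤K n+K≤b = begin
  ∑↘ (suc k) b (λ s → shift (exponent m w r (suc k) s + e * lastOr0 s) (denominator D s) n)
    ≡⟨ ∑↘-last k b (λ s → shift (exponent m w r (suc k) s + e * lastOr0 s) (denominator D s) n) ⟩
  ∑ (suc b) (λ p → ∑↘ k (b ∸ p) (λ t → shift (exponent m w r (suc k) (raise p t) + e * lastOr0 (raise p t)) (denominator D (raise p t)) n))
    ≡⟨ ∑-cong (suc b) (λ p _ → inner p) ⟩
  ∑ (suc b) (λ p → term D (suc k) (w + r + e) (M k (w ∸ 1) (r ∸ 1)) m p n)
    ≡⟨ layer-truncate D k (w + r + e) (M k (w ∸ 1) (r ∸ 1)) m {n}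
         (s≤s (≤-trans (≤-trans (≤-reflexive (+-comm 1 n)) (+-monoʳ-≤ n (s≤s z≤n))) n+K≤b)) ⟨
  layer D (suc k) (w + r + e) (M k (w ∸ 1) (r ∸ 1)) m n ∎
  where
  open ≡-Reasoning
  inner : ∀ p → ∑↘ k (b ∸ p) (λ t → shift (exponent m w r (suc k) (raise p t) + e * lastOr0 (raise p t)) (denominator D (raise p t)) n)
    ≡ term D (suc k) (w + r + e) (M k (w ∸ 1) (r ∸ 1)) m p n
  inner p = begin
    ∑↘ k (b ∸ p) (λ t → shift (exponent m w r (suc k) (raise p t) + e * lastOr0 (raise p t)) (denominator D (raise p t)) n)
      ≡⟨ ∑↘-cong k (b ∸ p) summand ⟩
    ∑↘ k (b ∸ p) (λ t → shift E (D p ⊛ F t) n)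
      ≡⟨ ∑↘-shift E k (b ∸ p) (λ t → D p ⊛ F t) n ⟨
    shift E (λ i → ∑↘ k (b ∸ p) (λ t → (D p ⊛ F t) i)) n
      ≡⟨ shift-cong E n (λ i _ → ∑↘-⊛ (D p) k (b ∸ p) F i) ⟨
    shift E (D p ⊛ (λ i → ∑↘ k (b ∸ p) (λ t → F t i))) n
      ≡⟨ shift-cong E n (λ i E+i≤n → ⊛-congʳ (D p) i λ l l≤i →
           ∑↘-M k (m + 2 * p) l (∸-monoˡ-≤ 1 w≤K) (∸-monoˡ-≤ 1 r≤K) (bound E+i≤n l≤i)) ⟩
    term D (suc k) (w + r + e) (M k (w ∸ 1) (r ∸ 1)) m p n ∎
    where
    E = weight (suc k) (w + r + e) m p
    F : List ℕ → Series
    F t = shift (exponent (m + 2 * p) (w ∸ 1) (r ∸ 1) k t) (denominator invPoch t)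
    -- Since p ≤ 1 + E, each layer may use one more than the degree it consumes. This is why the
    -- cutoff is n plus the number of variables.
    bound : ∀ {i l} → E + i ≤ n → l ≤ i → l + k ≤ b ∸ p
    bound {i} {l} E+i≤n l≤i = m+n≤o⇒m≤o∸n (l + k) (≤-trans
      (+-mono-≤ (+-monoˡ-≤ k l≤i) (p≤1+weight k (w + r + e) m p))
      (≤-trans (≤-reflexive (solve 3 (λ i k E → i :+ k :+ (con 1 :+ E) := E :+ i :+ (con 1 :+ k)) refl i k E))
        (≤-trans (+-monoˡ-≤ (suc k) E+i≤n) n+K≤b)))
    summand : ∀ t → length t ≡ k →
      shift (exponent m w r (suc k) (raise p t) + e * lastOr0 (raise p t)) (denominator D (raise p t)) n ≡ shift E (D p ⊛ F t) n
    summand t refl = begin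
      shift (exponent m w r (suc k) (raise p t) + e * lastOr0 (raise p t)) (denominator D (raise p t)) n
        ≡⟨ shift-cong (exponent m w r (suc k) (raise p t) + e * lastOr0 (raise p t)) n (λ i _ → denominator-raise D p t i) ⟩
      shift (exponent m w r (suc k) (raise p t) + e * lastOr0 (raise p t)) (D p ⊛ denominator invPoch t) n
        ≡⟨ cong (λ z → shift z (D p ⊛ denominator invPoch t) n) (trans
             (cong₂ (λ a l → a + e * l) (exponent-raise m p t w≤K r≤K) (lastOr0-raise p t))
             (solve 7 (λ Q p m K x e X → Q :+ p :* (m :* K :+ x) :+ X :+ e :* p := Q :+ p :* (m :* K :+ (x :+ e)) :+ X) refl
               (suc k * (p * (p ∸ 1))) p m (suc k) (w + r) e X)) ⟩
      shift (E + X) (D p ⊛ denominator invPoch t) n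
        ≡⟨ shift-+ E X (D p ⊛ denominator invPoch t) n ⟩
      shift E (shift X (D p ⊛ denominator invPoch t)) n
        ≡⟨ shift-cong E n (λ i _ → ⊛-shift X (D p) (denominator invPoch t) i) ⟨
      shift E (D p ⊛ F t) n ∎
      where
      X = exponent (m + 2 * p) (w ∸ 1) (r ∸ 1) k t

∑↘-M zero m n z≤n z≤n _ = cong (λ e → shift (e + 0 + 0) one n) (*-zeroʳ m)
∑↘-M (suc k) {w} {r} {b} m n w≤K r≤K n+K≤b = trans
  (∑↘-cong (suc k) b λ s _ → cong (λ e → shift e (denominator invPoch s) n) (sym (+-identityʳ (exponent m w r (suc k) s))))
  (trans (∑↘-layer invPoch k 0 m n w≤K r≤K n+K≤b)
    (cong (λ x → layer invPoch (suc k) x (M k (w ∸ 1) (r ∸ 1)) m n) (+-identityʳ (w + r))))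

lhsPartial-layer : ∀ {j r} k {N} n → j + r ≤ suc k → n + suc k ≤ N →
  lhsPartial j r (suc k) N n ≡ layer invPoch2 (suc k) (suc k ∸ j + r + 1) (M k (suc k ∸ j ∸ 1) (r ∸ 1)) 0 n
lhsPartial-layer {j} {r} k {N} n j+r≤K n+K≤N = trans
  (sum-decreasing k N (λ s → shift (expo j r (suc k) s) (denInv s) n))
  (trans
    (∑↘-cong (suc k) N λ s _ → trans
      (shift-cong (expo j r (suc k) s) n λ i _ → denInv-denominator s i)
      (cong (λ e → shift e (denominator invPoch2 s) n) (expo-exponent r s (m+n≤o⇒m≤o j j+r≤K))))
    (∑↘-layer invPoch2 k 1 0 n (m∸n≤m (suc k) j) (m+n≤o⇒n≤o j j+r≤K) n+K≤N))

-- Frequency sequences as lists without trailing zeros.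

n%2≤1 : ∀ n → n % 2 ≤ 1
n%2≤1 n = s≤s⁻¹ (m%n<n n 2)

%2-+≡0 : ∀ c a → (c + a) % 2 ≡ 0 → a % 2 ≡ c % 2
%2-+≡0 zero          a eq = eq
%2-+≡0 (suc zero)    a eq = suc-%2 (suc a) eq
%2-+≡0 (suc (suc c)) a eq = %2-+≡0 c a eq

%2-≡⇒+ : ∀ c a → a % 2 ≡ c % 2 → (c + a) % 2 ≡ 0
%2-≡⇒+ zero          a eq = eq
%2-≡⇒+ (suc zero)    a eq = suc-%2 a eq
%2-≡⇒+ (suc (suc c)) a eq = %2-≡⇒+ c a eq

-- Keeps lists free of trailing zeros.
cons : ℕ → List ℕ → List ℕ
cons zero    []      = []
cons zero    (y ∷ f) = zero ∷ y ∷ f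
cons (suc x) f       = suc x ∷ f

get-cons-zero : ∀ x f → get (cons x f) 0 ≡ x
get-cons-zero zero    []      = refl
get-cons-zero zero    (y ∷ f) = refl
get-cons-zero (suc x) f       = refl

get-cons-suc : ∀ x f i → get (cons x f) (suc i) ≡ get f i
get-cons-suc zero    []      i = refl
get-cons-suc zero    (y ∷ f) i = refl
get-cons-suc (suc x) f       i = refl

sizeFrom-cons : ∀ m x f → sizeFrom m (cons x f) ≡ m * x + sizeFrom (suc m) f
sizeFrom-cons m zero    []      = sym (trans (+-identityʳ (m * 0)) (*-zeroʳ m))
sizeFrom-cons m zero    (y ∷ f) = refl
sizeFrom-cons m (suc x) f       = refl

noTrailingZero-cons : ∀ x f → NoTrailingZero f → NoTrailingZero (cons x f)
noTrailingZero-cons zero    []      _  = tt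
noTrailingZero-cons zero    (y ∷ f) nt = nt
noTrailingZero-cons (suc x) []      _  = λ ()
noTrailingZero-cons (suc x) (y ∷ f) nt = nt

∷-cons : ∀ x f → NoTrailingZero (x ∷ f) → x ∷ f ≡ cons x f × NoTrailingZero f
∷-cons zero    []      nt = ⊥-elim (nt refl)
∷-cons (suc x) []      nt = refl , tt
∷-cons zero    (y ∷ f) nt = refl , nt
∷-cons (suc x) (y ∷ f) nt = refl , nt

cons-injective : ∀ x {f g} → cons x f ≡ cons x g → f ≡ g
cons-injective zero    {[]}    {[]}    _    = refl
cons-injective zero    {y ∷ f} {z ∷ g} refl = refl
cons-injective (suc x)                 refl = refl

-- The last entry is nonzero and sits at a position at least m. In sizes below m the empty list
-- therefore remains alone, which is the base of the enumeration.
m≤sizeFrom : ∀ m x f → NoTrailingZero (x ∷ f) → m ≤ sizeFrom m (x ∷ f)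
m≤sizeFrom m zero    []      nt = ⊥-elim (nt refl)
m≤sizeFrom m (suc x) []      nt = ≤-trans (m≤m*n m (suc x)) (m≤m+n (m * suc x) 0)
m≤sizeFrom m x       (y ∷ f) nt = ≤-trans (≤-trans (n≤1+n m) (m≤sizeFrom (suc m) y f nt)) (m≤n+m _ (m * x))

-- Enumeration of the sequences of given size.

row : ℕ → (ℕ → List (List ℕ)) → ℕ → ℕ → List (List ℕ)
row m S n u = if m * u ≤ᵇ n then map (cons u) (S (n ∸ m * u)) else []

extend : ℕ → (ℕ → ℕ → List (List ℕ)) → ℕ → ℕ → List (List ℕ)
extend m S zero    n = []
extend m S (suc v) n = extend m S v n ++ row m (S v) n v

length-row : ∀ m S n u → length (row m S n u) ≡ shift (m * u) (λ i → length (S i)) n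
length-row m S n u with m * u ≤ᵇ n
... | true  = length-map (cons u) (S (n ∸ m * u))
... | false = refl

length-extend : ∀ m S v n → length (extend m S v n) ≡ ∑ v (λ u → shift (m * u) (λ i → length (S u i)) n)
length-extend m S zero    n = refl
length-extend m S (suc v) n = trans (length-++ (extend m S v n)) (trans
  (cong₂ _+_ (length-extend m S v n) (length-row m (S v) n v))
  (sym (∑-last v (λ u → shift (m * u) (λ i → length (S u i)) n))))

∈-row⁻ : ∀ m S n u {f} → f ∈ row m S n u → ∃ λ i → ∃ λ g → m * u + i ≡ n × g ∈ S i × f ≡ cons u g
∈-row⁻ m S n u f∈ with m * u ≤ᵇ n in eq
... | true with ∈-map⁻ (cons u) f∈
...   | g , g∈ , f≡ = n ∸ m * u , g , m+[n∸m]≡n (≤ᵇ⇒≤ (m * u) n (subst T (sym eq) tt)) , g∈ , f≡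

∈-row⁺ : ∀ m S u {i g} → g ∈ S i → cons u g ∈ row m S (m * u + i) u
∈-row⁺ m S u {i} {g} g∈ with m * u ≤ᵇ m * u + i in eq
... | true  = ∈-map⁺ (cons u) (subst (λ i → g ∈ S i) (sym (m+n∸m≡n (m * u) i)) g∈)
... | false = ⊥-elim (subst T eq (≤⇒≤ᵇ (m≤m+n (m * u) i)))

∈-extend⁻ : ∀ m S v n {f} → f ∈ extend m S v n →
  ∃ λ u → ∃ λ i → ∃ λ g → u < v × m * u + i ≡ n × g ∈ S u i × f ≡ cons u g
∈-extend⁻ m S (suc v) n f∈ with ∈-++⁻ (extend m S v n) f∈
... | inj₁ f∈′ with ∈-extend⁻ m S v n f∈′
...   | u , i , g , u<v , rest = u , i , g , m<n⇒m<1+n u<v , rest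
∈-extend⁻ m S (suc v) n f∈ | inj₂ f∈′ with ∈-row⁻ m (S v) n v f∈′
...   | i , g , rest = v , i , g , n<1+n v , rest

∈-extend⁺ : ∀ m S v {u i g} → u < v → g ∈ S u i → cons u g ∈ extend m S v (m * u + i)
∈-extend⁺ m S (suc v) {u} {i} u<v g∈ with m<1+n⇒m<n∨m≡n u<v
... | inj₁ u<v′ = ∈-++⁺ˡ (∈-extend⁺ m S v u<v′ g∈)
... | inj₂ refl = ∈-++⁺ʳ (extend m S v (m * u + i)) (∈-row⁺ m (S v) v g∈)

-- Rows for different u are disjoint because `get f 0` recovers u.
extend-unique : ∀ m S v n → (∀ u i → Unique (S u i)) → Unique (extend m S v n)
extend-unique m S zero    n unique = []
extend-unique m S (suc v) n unique = ++⁺ (extend-unique m S v n unique) row-unique disjoint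
  where
  row-unique : Unique (row m (S v) n v)
  row-unique with m * v ≤ᵇ n
  ... | true  = map⁺ (cons-injective v) (unique v (n ∸ m * v))
  ... | false = []
  disjoint : ∀ {f} → f ∈ extend m S v n × f ∈ row m (S v) n v → ⊥
  disjoint (f∈ , f∈′) with ∈-extend⁻ m S v n f∈ | ∈-row⁻ m (S v) n v f∈′
  ... | u , i , g , u<v , _ , _ , f≡ | i′ , g′ , _ , _ , f≡′ =
    <⇒≢ u<v (trans (sym (get-cons-zero u g)) (trans (cong (λ f → get f 0) (trans (sym f≡) f≡′)) (get-cons-zero v g′)))

module Enumeration (c k : ℕ) where

  open Bressoud c k

  private
    K = suc k

  δ≤1 : ∀ w m → δ w m ≤ 1
  δ≤1 w m = n%2≤1 (c + m * K + w)

  -- d bounds the number of entries; d > n − m suffices.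
  sequences : ℕ → ℕ → ℕ → ℕ → List (List ℕ)
  sequences zero    w m zero    = if w ≤ᵇ K then [] ∷ [] else []
  sequences zero    w m (suc n) = []
  sequences (suc d) w m n       = extend m (λ u → sequences d (δ (K ∸ u) m + u) (suc m)) (suc K ∸ w) n

  sequences-unique : ∀ d w m n → Unique (sequences d w m n)
  sequences-unique zero w m zero with w ≤ᵇ K
  ... | true  = [] ∷ []
  ... | false = []
  sequences-unique zero    w m (suc n) = []
  sequences-unique (suc d) w m n       =
    extend-unique m (λ u → sequences d (δ (K ∸ u) m + u) (suc m)) (suc K ∸ w) n
      λ u → sequences-unique d (δ (K ∸ u) m + u) (suc m)

  -- The enumeration obeys the recursion of `H-sum`. The bound w ≤ K+1 is inherited by the next
  -- entry since δ ≤ 1 and u ≤ K; at w = K+1 both sides are zero.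
  length-sequences : ∀ d {w m} n → w ≤ suc K → n < m + d → length (sequences d w m n) ≡ H w m n
  length-sequences zero {w} {m} n w≤ n<m+0 with m≤n⇒m<n∨m≡n w≤ | subst (n <_) (+-identityʳ m) n<m+0
  length-sequences zero {w} zero    _ _ | inj₁ (s≤s w≤K) | n<m =
    trans (cong (λ b → length {A = List ℕ} (if b then [] ∷ [] else [])) (dec-true (w ≤? K) w≤K)) (sym (H-low w≤K n<m))
  length-sequences zero     (suc n) _ _ | inj₁ (s≤s w≤K) | n<m = sym (H-low w≤K n<m)
  length-sequences zero {m = m} zero    _ _ | inj₂ refl  | _   =
    trans (cong (λ b → length {A = List ℕ} (if b then [] ∷ [] else [])) (dec-false (suc K ≤? K) 1+n≰n)) (sym (H-beyond m 0))
  length-sequences zero {m = m} (suc n) _ _ | inj₂ refl  | _   = sym (H-beyond m (suc n))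
  length-sequences (suc d) {w} {m} n w≤ n<m+d = begin
    length (extend m (λ u → sequences d (δ (K ∸ u) m + u) (suc m)) (suc K ∸ w) n)
      ≡⟨ length-extend m (λ u → sequences d (δ (K ∸ u) m + u) (suc m)) (suc K ∸ w) n ⟩
    ∑ (suc K ∸ w) (λ u → shift (m * u) (λ i → length (sequences d (δ (K ∸ u) m + u) (suc m) i)) n)
      ≡⟨ ∑-cong (suc K ∸ w) (λ u u<v → shift-cong (m * u) n λ i i≤n →
           length-sequences d i (+-mono-≤ (δ≤1 (K ∸ u) m) (s≤s⁻¹ (≤-trans u<v (m∸n≤m (suc K) w))))
             (≤-<-trans (≤-trans (m≤n+m i (m * u)) i≤n) (subst (n <_) (+-suc m d) n<m+d))) ⟩
    ∑ (suc K ∸ w) (λ u → shift (m * u) (H (δ (K ∸ u) m + u) (suc m)) n)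
      ≡⟨ H-sum (suc K ∸ w) m n (m∸n+n≡m w≤) ⟩
    H w m n ∎
    where open ≡-Reasoning

  -- For `[]`, a sequence of zeros, only the first zero meets w; every later one meets a bound δ ≤ 1
  -- ≤ K.
  Admissible : ℕ → ℕ → List ℕ → Set
  Admissible w m []      = w ≤ K
  Admissible w m (x ∷ f) = x + w ≤ K × Admissible (δ (K ∸ x) m + x) (suc m) f

  admissible-cons : ∀ {w m} x f → x + w ≤ K → Admissible (δ (K ∸ x) m + x) (suc m) f → Admissible w m (cons x f)
  admissible-cons zero    []      w≤K _   = w≤K
  admissible-cons zero    (y ∷ f) w≤K adm = w≤K , adm
  admissible-cons (suc x) f       w≤K adm = w≤K , adm

  ∈-sequences⁻ : ∀ d {w m n f} → n < m + d → f ∈ sequences d w m n →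
    NoTrailingZero f × Admissible w m f × sizeFrom m f ≡ n
  ∈-sequences⁻ zero {w} {n = zero} _ f∈ with w ≤ᵇ K in eq
  ∈-sequences⁻ zero {w} {n = zero} _ (here refl) | true = tt , ≤ᵇ⇒≤ w K (subst T (sym eq) tt) , refl
  ∈-sequences⁻ (suc d) {w} {m} {n} n<m+d f∈
    with ∈-extend⁻ m (λ u → sequences d (δ (K ∸ u) m + u) (suc m)) (suc K ∸ w) n f∈
  ... | u , i , g , u<v , refl , g∈ , refl
    with ∈-sequences⁻ d (≤-<-trans (m≤n+m i (m * u)) (subst (n <_) (+-suc m d) n<m+d)) g∈
  ... | nt , adm , refl = noTrailingZero-cons u g nt ,
    admissible-cons u g (s≤s⁻¹ (m≤o∸n⇒m+n≤o (suc u) w≤1+K u<v)) adm , sizeFrom-cons m u g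
    where
    w≤1+K : w ≤ suc K
    w≤1+K = <⇒≤ (m∸n≢0⇒n<m λ eq → n≮0 (subst (u <_) eq u<v))

  ∈-sequences⁺ : ∀ d {w m} f → sizeFrom m f < m + d → NoTrailingZero f → Admissible w m f →
    f ∈ sequences d w m (sizeFrom m f)
  ∈-sequences⁺ zero {w} [] _ _ w≤K =
    subst (λ b → [] ∈ (if b then [] ∷ [] else [])) (sym (dec-true (w ≤? K) w≤K)) (here refl)
  ∈-sequences⁺ zero {m = m} (x ∷ f) size<m nt _ =
    ⊥-elim (<⇒≱ (subst (sizeFrom m (x ∷ f) <_) (+-identityʳ m) size<m) (m≤sizeFrom m x f nt))
  ∈-sequences⁺ (suc d) {w} {m} f size<m nt adm = cons-∈ (uncons f nt adm)
    where
    uncons : ∀ f → NoTrailingZero f → Admissible w m f →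
      ∃ λ x → ∃ λ g → f ≡ cons x g × x + w ≤ K × NoTrailingZero g × Admissible (δ (K ∸ x) m + x) (suc m) g
    uncons []      _  w≤K = 0 , [] , refl , w≤K , tt , ≤-trans (≤-reflexive (+-identityʳ _)) (≤-trans (δ≤1 K m) (s≤s z≤n))
    uncons (x ∷ f) nt (x≤ , adm) with ∷-cons x f nt
    ... | f≡ , nt′ = x , f , f≡ , x≤ , nt′ , adm
    cons-∈ : (∃ λ x → ∃ λ g → f ≡ cons x g × x + w ≤ K × NoTrailingZero g × Admissible (δ (K ∸ x) m + x) (suc m) g) →
      f ∈ sequences (suc d) w m (sizeFrom m f)
    cons-∈ (x , g , refl , x≤ , nt , adm) =
      subst (λ n → cons x g ∈ sequences (suc d) w m n) (sym (sizeFrom-cons m x g))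
        (∈-extend⁺ m (λ u → sequences d (δ (K ∸ u) m + u) (suc m)) (suc K ∸ w)
          (m+n≤o⇒m≤o∸n (suc x) (s≤s x≤))
          (∈-sequences⁺ d g
            (≤-<-trans (≤-trans (m≤n+m _ (m * x)) (≤-reflexive (sym (sizeFrom-cons m x g)))) (subst (sizeFrom m (cons x g) <_) (+-suc m d) size<m))
            nt adm))

  Link : ℕ → ℕ → ℕ → Set
  Link m x y = x + y ≤ K × (x + y ≡ K → (m * x + suc m * y) % 2 ≡ c % 2)

  private
    link-parity : ∀ m {x y} → x + y ≡ K → m * K + y ≡ m * x + suc m * y
    link-parity m {x} {y} eq = trans (cong (λ K → m * K + y) (sym eq))
      (solve 3 (λ m x y → m :* (x :+ y) :+ y := m :* x :+ (con 1 :+ m) :* y) refl m x y)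

    complement : ∀ {x y} → x + y ≡ K → K ∸ x ≡ y
    complement {x} {y} eq = trans (cong (_∸ x) (sym eq)) (m+n∸m≡n x y)

  -- If x + y = K, no room is left for δ, so δ = 0; and δ is the parity of c + mK + y, where mK + y
  -- = mx + (m+1)y.
  bound⇒link : ∀ m x y → y + (δ (K ∸ x) m + x) ≤ K → Link m x y
  bound⇒link m x y bound = ≤-trans (m≤n+m (x + y) δ₀) total , λ eq →
    trans (cong (_% 2) (sym (link-parity m eq)))
      (%2-+≡0 c (m * K + y) (trans (cong (_% 2) (sym (+-assoc c (m * K) y)))
        (trans (cong (λ y → δ y m) (sym (complement eq)))
          (n≤0⇒n≡0 (+-cancelʳ-≤ (x + y) δ₀ 0 (subst (δ₀ + (x + y) ≤_) (sym eq) total))))))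
    where
    δ₀ = δ (K ∸ x) m
    total : δ₀ + (x + y) ≤ K
    total = subst (_≤ K) (solve 3 (λ d x y → y :+ (d :+ x) := d :+ (x :+ y)) refl δ₀ x y) bound

  link⇒bound : ∀ m x y → Link m x y → y + (δ (K ∸ x) m + x) ≤ K
  link⇒bound m x y (x+y≤K , parity) = subst (_≤ K)
    (solve 3 (λ d x y → d :+ (x :+ y) := y :+ (d :+ x)) refl (δ (K ∸ x) m) x y) total
    where
    total : δ (K ∸ x) m + (x + y) ≤ K
    total with m≤n⇒m<n∨m≡n x+y≤K
    ... | inj₁ x+y<K = ≤-trans (+-monoˡ-≤ (x + y) (δ≤1 (K ∸ x) m)) x+y<K
    ... | inj₂ eq = ≤-reflexive (trans (cong (_+ (x + y)) (trans (cong (λ y → δ y m) (complement eq))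
      (trans (cong (_% 2) (+-assoc c (m * K) y))
        (%2-≡⇒+ c (m * K + y) (trans (cong (_% 2) (link-parity m eq)) (parity eq)))))) eq)

  admissible⇒links : ∀ {w} m f → Admissible w m f →
    get f 0 + w ≤ K × (∀ i → Link (m + i) (get f i) (get f (suc i)))
  admissible⇒links m []      w≤K = w≤K , λ _ → z≤n , λ ()
  admissible⇒links m (x ∷ f) (x≤ , adm) with admissible⇒links (suc m) f adm
  ... | bound , links = x≤ , λ where
    zero    → subst (λ m → Link m x (get f 0)) (sym (+-identityʳ m)) (bound⇒link m x (get f 0) bound)
    (suc i) → subst (λ m → Link m (get f i) (get f (suc i))) (sym (+-suc m i)) (links i)

  links⇒admissible : ∀ {w} m f → get f 0 + w ≤ K → (∀ i → Link (m + i) (get f i) (get f (suc i))) → Admissible w m f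
  links⇒admissible m []      w≤K _     = w≤K
  links⇒admissible m (x ∷ f) x≤  links = x≤ , links⇒admissible (suc m) f
    (link⇒bound m x (get f 0) (subst (λ m → Link m x (get f 0)) (+-identityʳ m) (links 0)))
    (λ i → subst (λ m → Link m (get f i) (get f (suc i))) (+-suc m i) (links (suc i)))

  -- The conditions at position 0.

  -- Conditions (i)–(iii) allow f_0 = u ≤ j and then require f_1 + next j r u ≤ K.
  next : ℕ → ℕ → ℕ → ℕ
  next j r u = (δ (K ∸ u) 0 + u) ⊔ ((2 * u + r) ∸ j)

  -- Without truncation both inequalities say 2x + y + r ≤ K + j. Where 2x + r ≤ j, the bound is x +
  -- y ≤ K weakened.
  cond-ii⇒bound : ∀ j {r x y} → r ≤ K → x + y ≤ K → x + ((x + y) ∸ (K ∸ r)) ≤ j → y + ((2 * x + r) ∸ j) ≤ K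
  cond-ii⇒bound j {r} {x} {y} r≤K x+y≤K cond with ≤-total (2 * x + r) j
  ... | inj₁ le = subst (_≤ K) (sym (trans (cong (y +_) (m≤n⇒m∸n≡0 le)) (+-identityʳ y))) (m+n≤o⇒n≤o x x+y≤K)
  ... | inj₂ ge = +-cancelʳ-≤ j (y + ((2 * x + r) ∸ j)) K (begin
    y + ((2 * x + r) ∸ j) + j           ≡⟨ trans (+-assoc y _ j) (cong (y +_) (m∸n+n≡m ge)) ⟩
    y + (2 * x + r)                     ≡⟨ solve 3 (λ x y r → y :+ (con 2 :* x :+ r) := x :+ y :+ (x :+ r)) refl x y r ⟩
    x + y + (x + r)                     ≤⟨ +-monoˡ-≤ (x + r) (m≤n+m∸n (x + y) (K ∸ r)) ⟩
    K ∸ r + ((x + y) ∸ (K ∸ r)) + (x + r) ≡⟨ solve 4 (λ a z x r → a :+ z :+ (x :+ r) := (a :+ r) :+ (x :+ z)) refl (K ∸ r) ((x + y) ∸ (K ∸ r)) x r ⟩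
    K ∸ r + r + (x + ((x + y) ∸ (K ∸ r))) ≤⟨ +-mono-≤ (≤-reflexive (m∸n+n≡m r≤K)) cond ⟩
    K + j                               ∎)
    where open ≤-Reasoning

  bound⇒cond-ii : ∀ {j r x y} → r ≤ K → x ≤ j → y + ((2 * x + r) ∸ j) ≤ K → x + ((x + y) ∸ (K ∸ r)) ≤ j
  bound⇒cond-ii {j} {r} {x} {y} r≤K x≤j bound = begin
    x + ((x + y) ∸ (K ∸ r)) ≤⟨ +-monoʳ-≤ x (m≤n+o⇒m∸n≤o (x + y) (K ∸ r) (+-cancelʳ-≤ (x + r) (x + y) (K ∸ r + (j ∸ x)) total)) ⟩
    x + (j ∸ x)             ≡⟨ m+[n∸m]≡n x≤j ⟩
    j                       ∎
    where
    open ≤-Reasoning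
    total : x + y + (x + r) ≤ K ∸ r + (j ∸ x) + (x + r)
    total = begin
      x + y + (x + r)                 ≡⟨ solve 3 (λ x y r → x :+ y :+ (x :+ r) := y :+ (con 2 :* x :+ r)) refl x y r ⟩
      y + (2 * x + r)                 ≤⟨ +-monoʳ-≤ y (m≤n+m∸n (2 * x + r) j) ⟩
      y + (j + ((2 * x + r) ∸ j))     ≡⟨ solve 3 (λ y j z → y :+ (j :+ z) := y :+ z :+ j) refl y j ((2 * x + r) ∸ j) ⟩
      y + ((2 * x + r) ∸ j) + j       ≤⟨ +-monoˡ-≤ j bound ⟩
      K + j                           ≡⟨ cong₂ _+_ (sym (m∸n+n≡m r≤K)) (sym (m∸n+n≡m x≤j)) ⟩
      K ∸ r + r + (j ∸ x + x)         ≡⟨ solve 4 (λ a r b x → a :+ r :+ (b :+ x) := a :+ b :+ (x :+ r)) refl (K ∸ r) r (j ∸ x) x ⟩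
      K ∸ r + (j ∸ x) + (x + r)       ∎

  next-≤ : ∀ {j r u} → j + r ≤ K → u ≤ j → next j r u ≤ suc K
  next-≤ {j} {r} {u} j+r≤K u≤j = ⊔-lub
    (+-mono-≤ (δ≤1 (K ∸ u) 0) (≤-trans u≤j (m+n≤o⇒m≤o j j+r≤K)))
    (≤-trans (m≤n+o⇒m∸n≤o (2 * u + r) j (≤-trans
        (≤-reflexive (solve 2 (λ u r → con 2 :* u :+ r := u :+ (u :+ r)) refl u r))
        (+-mono-≤ u≤j (+-monoˡ-≤ r u≤j))))
      (≤-trans j+r≤K (n≤1+n K)))

  -- Induction on r. At r = 0 the multisum is `H w 0`. For r ≥ 1 splitting the layer separates u =
  -- j, where the second argument of `next` is the larger one, with value r + j.
  layer-next : ∀ r {j w} n → j + w ≡ K → r ≤ w → c ≡ w + r + 1 →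
    layer invPoch2 K (w + r + 1) (M k (w ∸ 1) (r ∸ 1)) 0 n ≡ ∑ (suc j) (λ u → H (next j r u) 1 n)
  layer-next zero {j} {w} n j+w _ c≡ = begin
    layer invPoch2 K (w + 0 + 1) (M k (w ∸ 1) 0) 0 n
      ≡⟨ cong (λ x → layer invPoch2 K (x + 1) (M k (w ∸ 1) 0) 0 n) (+-identityʳ w) ⟩
    layer invPoch2 K (w + 1) (M k (w ∸ 1) 0) 0 n
      ≡⟨ cong (λ A → A n) (H-≡ w 0 odd) ⟨
    H w 0 n
      ≡⟨ H-sum (suc j) 0 n (cong suc j+w) ⟨
    ∑ (suc j) (λ u → H (δ (K ∸ u) 0 + u) 1 n)
      ≡⟨ ∑-cong (suc j) (λ u u≤j → cong (λ w → H w 1 n) (sym (m≥n⇒m⊔n≡m (second≤ u (s≤s⁻¹ u≤j))))) ⟩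
    ∑ (suc j) (λ u → H (next j 0 u) 1 n) ∎
    where
    open ≡-Reasoning
    -- With r = 0 the constant c is w + 1, so c + w is odd. This makes δ supply the extra s_k of the
    -- given multisum.
    odd : δ w 0 ≡ 1
    odd = %2-shift w (trans (cong (λ c → c + 0 + w) c≡)
      (solve 1 (λ w → w :+ con 0 :+ con 1 :+ con 0 :+ w := con 1 :+ w :* con 2) refl w))
    second≤ : ∀ u → u ≤ j → (2 * u + 0) ∸ j ≤ δ (K ∸ u) 0 + u
    second≤ u u≤j = ≤-trans (m≤n+o⇒m∸n≤o (2 * u + 0) j (≤-trans
        (≤-reflexive (solve 1 (λ u → con 2 :* u :+ con 0 := u :+ u) refl u)) (+-monoˡ-≤ u u≤j)))
      (m≤n+m u (δ (K ∸ u) 0))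
  layer-next (suc r) {j} {w} n j+w r≤w c≡ = begin
    layer invPoch2 K (w + suc r + 1) (M k (w ∸ 1) r) 0 n
      ≡⟨ layer-split invPoch2 k (M k (w ∸ 1) r) (M k w (r ∸ 1)) (M k (r + j) 0) 0 exponents (M-step-below k j+w r≤w) n ⟩
    layer invPoch2 K (w + suc r + 1) (M k w (r ∸ 1)) 0 n + layer invPoch2 K (suc r + j + 1) (M k (r + j) 0) 1 n
      ≡⟨ cong₂ _+_ (smaller j+w) (sym (trans (cong (λ w → H w 1 n) last) (cong (λ A → A n) (H-≡ (suc r + j) 1 odd)))) ⟩
    ∑ j (λ u → H (next j (suc r) u) 1 n) + H (next j (suc r) j) 1 n
      ≡⟨ ∑-last j (λ u → H (next j (suc r) u) 1 n) ⟨
    ∑ (suc j) (λ u → H (next j (suc r) u) 1 n) ∎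
    where
    open ≡-Reasoning
    exponents : K + (suc r + j + 1) ≡ w + suc r + 1 + 2 * j
    exponents = trans (cong (_+ (suc r + j + 1)) (sym j+w))
      (solve 3 (λ j w r → j :+ w :+ (con 1 :+ r :+ j :+ con 1) := w :+ (con 1 :+ r) :+ con 1 :+ con 2 :* j) refl j w r)
    odd : δ (suc r + j) 1 ≡ 1
    odd = %2-shift (w + suc r + j) (trans (cong₂ (λ c K → c + 1 * K + (suc r + j)) c≡ (sym j+w))
      (solve 3 (λ j w r → (w :+ r :+ con 1) :+ con 1 :* (j :+ w) :+ (r :+ j) := con 1 :+ (w :+ r :+ j) :* con 2) refl j w (suc r)))
    last : next j (suc r) j ≡ suc r + j
    last = trans (cong (δ (K ∸ j) 0 + j ⊔_) (trans
        (cong (_∸ j) (solve 2 (λ j r → con 2 :* j :+ r := j :+ (r :+ j)) refl j (suc r))) (m+n∸m≡n j (suc r + j))))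
      (m≤n⇒m⊔n≡n (+-monoˡ-≤ j (≤-trans (δ≤1 (K ∸ j) 0) (s≤s z≤n))))
    -- For u < j, replacing j and r+1 by j-1 and r changes neither c nor 2u + r - j, hence not
    -- `next`. For j = 0 no such u exists and the layer is zero.
    smaller : ∀ {j} → j + w ≡ K → layer invPoch2 K (w + suc r + 1) (M k w (r ∸ 1)) 0 n ≡ ∑ j (λ u → H (next j (suc r) u) 1 n)
    smaller {zero}  refl = layer-0# invPoch2 K (w + suc r + 1) (M k w (r ∸ 1)) 0 (M-beyond k (r ∸ 1)) n
    smaller {suc j} j+w  = begin
      layer invPoch2 K (w + suc r + 1) (M k w (r ∸ 1)) 0 n
        ≡⟨ cong (λ x → layer invPoch2 K (x + 1) (M k w (r ∸ 1)) 0 n) (+-suc w r) ⟩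
      layer invPoch2 K (suc w + r + 1) (M k w (r ∸ 1)) 0 n
        ≡⟨ layer-next r n (trans (+-suc j w) j+w) (≤-trans (n≤1+n r) (≤-trans r≤w (n≤1+n w))) (trans c≡ (cong (_+ 1) (+-suc w r))) ⟩
      ∑ (suc j) (λ u → H (next j r u) 1 n)
        ≡⟨ ∑-cong (suc j) (λ u _ → cong (λ z → H (δ (K ∸ u) 0 + u ⊔ (z ∸ suc j)) 1 n) (sym (+-suc (2 * u) r))) ⟩
      ∑ (suc j) (λ u → H (next (suc j) (suc r) u) 1 n) ∎

theorem1p16 : ∀ (j r k : ℕ) → 1 ≤ k → j + r ≤ k → ∀ (n : ℕ) →
    Σ (List (List ℕ)) λ L →
    Unique L
    × (∀ f → (f ∈ L) ⇔ (NoTrailingZero f × Cond j r k f × size f ≡ n))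
    × ∃ λ N₀ → ∀ N → N₀ ≤ N → lhsPartial j r k N n ≡ length L
theorem1p16 j r (suc k) _ j+r≤K n =
  L , extend-unique 0 S (suc j) n (λ u → sequences-unique n (next j r u) 1) , (λ f → mk⇔ (sound f) (complete f)) , n + K , count
  where
  K = suc k
  open Bressoud (K + r ∸ j + 1) k
  open Enumeration (K + r ∸ j + 1) k
  S : ℕ → ℕ → List (List ℕ)
  -- The entry f_0 contributes nothing to the size. The remaining entries start at position 1, where
  -- depth n suffices because n < 1 + n.
  S u = sequences n (next j r u) 1
  L = extend 0 S (suc j) n
  r≤K : r ≤ K
  r≤K = m+n≤o⇒n≤o j j+r≤K
  j≤K : j ≤ K
  j≤K = m+n≤o⇒m≤o j j+r≤K

  sound : ∀ f → f ∈ L → NoTrailingZero f × Cond j r K f × size f ≡ n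
  sound f f∈ with ∈-extend⁻ 0 S (suc j) n f∈
  ... | x , i , g , s≤s x≤j , refl , g∈ , refl with ∈-sequences⁻ n (n<1+n n) g∈
  ...   | nt , adm , size≡ with admissible⇒links 1 g adm
  ...     | bound , links = noTrailingZero-cons x g nt , record
    { cond-i   = λ i → proj₁ (links′ i)
    ; cond-ii  = subst₂ (λ x y → x + ((x + y) ∸ (K ∸ r)) ≤ j) (sym (get-cons-zero x g)) (sym (get-cons-suc x g 0))
        (bound⇒cond-ii r≤K x≤j (≤-trans (+-monoʳ-≤ (get g 0) (m≤n⊔m (δ (K ∸ x) 0 + x) (2 * x + r ∸ j))) bound))
    ; cond-iii = λ i → proj₂ (links′ i)
    } , trans (sizeFrom-cons 0 x g) size≡
    where
    links′ : ∀ i → Link i (get (cons x g) i) (get (cons x g) (suc i))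
    links′ zero    = subst₂ (Link 0) (sym (get-cons-zero x g)) (sym (get-cons-suc x g 0))
      (bound⇒link 0 x (get g 0) (≤-trans (+-monoʳ-≤ (get g 0) (m≤m⊔n (δ (K ∸ x) 0 + x) (2 * x + r ∸ j))) bound))
    links′ (suc i) = subst₂ (Link (suc i)) (sym (get-cons-suc x g i)) (sym (get-cons-suc x g (suc i))) (links i)

  complete : ∀ f → NoTrailingZero f × Cond j r K f × size f ≡ n → f ∈ L
  complete f (nt , cond , refl) = cons-∈ (uncons f nt)
    where
    open Cond cond
    uncons : ∀ f → NoTrailingZero f → ∃ λ x → ∃ λ g → f ≡ cons x g × NoTrailingZero g
    uncons []      _  = 0 , [] , refl , tt
    uncons (x ∷ f) nt = x , f , ∷-cons x f nt
    cons-∈ : (∃ λ x → ∃ λ g → f ≡ cons x g × NoTrailingZero g) → f ∈ L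
    cons-∈ (x , g , refl , nt) = subst (λ n → cons x g ∈ extend 0 S (suc j) n) (sym size≡)
      (∈-extend⁺ 0 S (suc j) (s≤s (m+n≤o⇒m≤o x cond-ii′))
        (∈-sequences⁺ (size (cons x g)) g (s≤s (≤-reflexive (sym size≡))) nt
          (links⇒admissible 1 g bound λ i →
            subst₂ (Link (suc i)) (get-cons-suc x g i) (get-cons-suc x g (suc i)) (links (suc i)))))
      where
      links : ∀ i → Link i (get (cons x g) i) (get (cons x g) (suc i))
      links i = cond-i i , cond-iii i
      size≡ : size (cons x g) ≡ sizeFrom 1 g
      size≡ = sizeFrom-cons 0 x g
      link₀ : Link 0 x (get g 0)
      link₀ = subst₂ (Link 0) (get-cons-zero x g) (get-cons-suc x g 0) (links 0)
      cond-ii′ : x + ((x + get g 0) ∸ (K ∸ r)) ≤ j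
      cond-ii′ = subst₂ (λ x y → x + ((x + y) ∸ (K ∸ r)) ≤ j) (get-cons-zero x g) (get-cons-suc x g 0) cond-ii
      bound : get g 0 + next j r x ≤ K
      bound = subst (_≤ K) (sym (+-distribˡ-⊔ (get g 0) (δ (K ∸ x) 0 + x) (2 * x + r ∸ j)))
        (⊔-lub (link⇒bound 0 x (get g 0) link₀) (cond-ii⇒bound j r≤K (proj₁ link₀) cond-ii′))

  count : ∀ N → n + K ≤ N → lhsPartial j r K N n ≡ length L
  count N n+K≤N = begin
    lhsPartial j r K N n
      ≡⟨ lhsPartial-layer {j} {r} k n j+r≤K n+K≤N ⟩
    layer invPoch2 K (K ∸ j + r + 1) (M k (K ∸ j ∸ 1) (r ∸ 1)) 0 n
      ≡⟨ layer-next r n (m+[n∸m]≡n j≤K) (m+n≤o⇒m≤o∸n r (≤-trans (≤-reflexive (+-comm r j)) j+r≤K)) (cong (_+ 1) (+-∸-comm r j≤K)) ⟩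
    ∑ (suc j) (λ u → H (next j r u) 1 n)
      ≡⟨ ∑-cong (suc j) (λ u u≤j → length-sequences n n (next-≤ j+r≤K (s≤s⁻¹ u≤j)) (n<1+n n)) ⟨
    ∑ (suc j) (λ u → length (S u n))
      ≡⟨ length-extend 0 S (suc j) n ⟨
    length L ∎
    where open ≡-Reasoning
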